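{- $\mathrm{Ratio}_{v,z}(n) \in \Theta(\log n)$ as $n\to\infty$; that is, the worst-case ratio of the number of lex-parse phrases to the number of Lempel--Ziv phrases over strings of length $n$ is $\Theta(\log n)$.
   Context: $\mathrm{Ratio}_{v,z}(n)=\max_{S\in\Sigma^n} v(S)/z(S)$, where $S$ ranges over all strings of length $n$ over totally ordered alphabets $(\Sigma,\prec)$ of unrestricted size (the number of distinct characters may grow with $n$). Strings are indexed from $0$: a string $S$ of length $n=|S|$ is $S[0]\cdots S[n-1]$, and $S[i..j]$ is the substring from position $i$ to position $j$. A factorization of $S$ is a sequence of nonempty strings (phrases) $F_1,\dots,F_m$ with $S=F_1\cdots F_m$; the starting position of $F_i$ is $b_i=\sum_{k=1}^{i-1}|F_k|$. The Lempel--Ziv (LZ) factorization of $S$ is built from left to right: if the character $S[b_i]$ has no occurrence in $S$ starting before $b_i$, then $F_i=S[b_i]$; otherwise $F_i$ is the longest prefix of $S[b_i..n-1]$ that has an occurrence in $S$ starting before $b_i$ (this earlier occurrence may overlap $F_i$). The number of its phrases is denoted $z(S)$. Let $\prec$ be a total order on $\Sigma$, extended to the lexicographic order on $\Sigma^*$ (a proper prefix of a string is smaller than the string). Let $\mathrm{LCP}(X,Y)$ be the length of the longest common prefix of $X$ and $Y$. The lex-parse of $S$ with respect to $\prec$ is the factorization $F_1,\dots,F_m$ built from left to right as follows: let $\ell_i$ be the maximum of $\mathrm{LCP}(S[b_i..n-1],S[p..n-1])$ over all positions $0\le p<n$ with $S[p..n-1]\prec S[b_i..n-1]$, and $\ell_i=0$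 if no such $p$ exists; then $F_i=S[b_i..b_i+\max\{\ell_i,1\}-1]$. The number of its phrases is denoted $v_\prec(S)$, or $v(S)$. -}

module Defs where

open import Data.Bool.Base using (if_then_else_)
open import Data.Integer.Base using (+_)
open import Data.List.Base using (List; []; _∷_; length; take; drop; map; filter; upTo)
open import Data.List.Extrema.Nat using (max)
open import Data.List.Relation.Binary.Lex.Strict using (Lex-<; <-decidable)
open import Data.List.Relation.Binary.Prefix.Heterogeneous using (Prefix)
open import Data.List.Relation.Binary.Prefix.Heterogeneous.Properties using (prefix?)
open import Data.Nat.Base using (ℕ; zero; suc; _+_; _∸_; _⊔_; _<_; _<ᵇ_; _≥_; NonZero)
open import Data.Nat.Logarithm using (⌊log₂_⌋)
open import Data.Nat.Properties using (anyUpTo?)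
open import Data.Product.Base using (∃; ∃-syntax; _×_)
open import Data.Rational.Base as ℚ using (ℚ; 0ℚ; _/_)
open import Data.Vec.Base using (Vec; []; _∷_; toList)
open import Level using (0ℓ)
open import Relation.Binary.Bundles using (StrictTotalOrder)
open import Relation.Binary.PropositionalEquality.Core using (_≡_)
open import Relation.Nullary.Decidable.Core using (Dec; does)

Alphabet : Set₁
Alphabet = StrictTotalOrder 0ℓ 0ℓ 0ℓ

-- In the factorization of S whose phrase starting at position b has length
-- len b, the phrases starting at or after b.  The first argument only serves
-- structural recursion: every phrase below has length at least 1, so length S
-- steps always suffice.
phrasesFrom : ∀ {A : Set} → ℕ → (len : ℕ → ℕ) → List A → ℕ → List (List A)
phrasesFrom zero       len S b = []
phrasesFrom (suc fuel) len S b =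
  if b <ᵇ length S
  then take (len b) (drop b S) ∷ phrasesFrom fuel len S (b + len b)
  else []

factorize : ∀ {A : Set} → (len : ℕ → ℕ) → List A → List (List A)
factorize len S = phrasesFrom (length S) len S 0

module Parsing (Σ : Alphabet) where
  open StrictTotalOrder Σ using (Carrier; _≈_; _≟_; _<?_) renaming (_<_ to _≺_)

  OccursBefore : List Carrier → ℕ → List Carrier → Set
  OccursBefore S b X = ∃[ p ] p < b × Prefix _≈_ X (drop p S)

  occursBefore? : ∀ S b X → Dec (OccursBefore S b X)
  occursBefore? S b X = anyUpTo? (λ p → prefix? _≟_ X (drop p S)) b

  lzLength : List Carrier → ℕ → ℕ
  lzLength S b =
    if does (occursBefore? S b (take 1 (drop b S)))
    then max 0 (filter (λ ℓ → occursBefore? S b (take ℓ (drop b S)))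
                       (upTo (suc (length S ∸ b))))
    else 1

  lzFactorization : List Carrier → List (List Carrier)
  lzFactorization S = factorize (lzLength S) S

  lcp : List Carrier → List Carrier → ℕ
  lcp []       _        = 0
  lcp (_ ∷ _)  []       = 0
  lcp (x ∷ xs) (y ∷ ys) = if does (x ≟ y) then suc (lcp xs ys) else 0

  _≺ˡᵉˣ_ : List Carrier → List Carrier → Set
  _≺ˡᵉˣ_ = Lex-< _≈_ _≺_

  _≺ˡᵉˣ?_ : ∀ X Y → Dec (X ≺ˡᵉˣ Y)
  _≺ˡᵉˣ?_ = <-decidable _≟_ _<?_

  maxSmallerLCP : List Carrier → ℕ → ℕ
  maxSmallerLCP S b =
    max 0 (map (λ p → lcp (drop b S) (drop p S))
               (filter (λ p → drop p S ≺ˡᵉˣ? drop b S) (upTo (length S))))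

  lexParse : List Carrier → List (List Carrier)
  lexParse S = factorize (λ b → maxSmallerLCP S b ⊔ 1) S

  z : ∀ {n} → Vec Carrier n → ℕ
  z S = length (lzFactorization (toList S))

  v : ∀ {n} → Vec Carrier n → ℕ
  v S = length (lexParse (toList S))

  z-nonZero : ∀ {n} .{{_ : NonZero n}} (S : Vec Carrier n) → NonZero (z S)
  z-nonZero (_ ∷ _) = _

  v/z : ∀ {n} .{{_ : NonZero n}} → Vec Carrier n → ℚ
  v/z S = (+ v S / z S) {{z-nonZero S}}

open Parsing public using (v/z)
open StrictTotalOrder public using (Carrier)

-- r is the maximum of v(S)/z(S) over the strings S of length n, the alphabet
-- varying as well.  Only n ≥ 1 is considered, the ratio being 0/0 for n = 0.
IsMaxRatio : (n : ℕ) .{{_ : NonZero n}} → ℚ → Set₁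
IsMaxRatio n r =
    (∃[ Σ ] ∃[ S ] v/z Σ {n} S ≡ r)
  × (∀ (Σ : Alphabet) (S : Vec (Carrier Σ) n) → v/z Σ S ℚ.≤ r)

infix 4 _∈Θ_

_∈Θ_ : (f g : ℕ → ℚ) → Set
f ∈Θ g = ∃[ c₁ ] ∃[ c₂ ] 0ℚ ℚ.< c₁ × 0ℚ ℚ.< c₂ ×
  ∃[ n₀ ] (∀ n → n ≥ n₀ → c₁ ℚ.* g n ℚ.≤ f n × f n ℚ.≤ c₂ ℚ.* g n)

-- The base of the logarithm and the rounding only affect the constants in Θ,
-- as log₂ n / 2 ≤ ⌊log₂ n⌋ ≤ log₂ n for n ≥ 2.
log : ℕ → ℚ
log n = + ⌊log₂ n ⌋ / 1

-- Upper bound.  Let a lex-parse phrase starting at b have length in [ℓ, 2ℓ).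
-- Since the LCP is maximal, the windows [b − ℓ, b + 3ℓ) of two such phrases
-- cannot have copies whose starting positions differ by less than ℓ.  Some copy
-- of each window meets a phrase boundary of the LZ parsing, so a boundary is
-- charged boundedly often for each of the log n scales ℓ = 2^σ.
--
-- Lower bound.  Let x and N be consecutive Fibonacci numbers, and let row e be
-- the permutation i ↦ i x mod N of [0, N) translated by e.  A row arises from
-- the previous one by exchanging two blocks and replacing one letter, so it
-- costs O(1) LZ phrases.  Modulo N all rows read the same cyclic sequence, so
-- two suffixes with the same first letter agree until one of the rows ends or
-- contains a letter out of the range of the other.  A lex-parse phrase therefore
-- ends at the latest where both the minimum and the maximum of the rest of the
-- row have been read; these lie at distances from the end of the row that are
-- Fibonacci numbers, which gives log N phrases per row.

module Submission where

open import Data.Bool.Base as Bool using (true; false)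
open import Data.Empty using (⊥)
open import Data.Fin.Base as Fin using (Fin; zero; suc; inject₁; toℕ; combine; fromℕ<)
import Data.Fin.Properties as Fin
import Data.Integer.Base as ℤ
import Data.Integer.Properties as ℤ
open import Data.List.Base
  using (List; []; _∷_; [_]; length; map; take; drop; filter; upTo; cartesianProductWith)
import Data.List.Extrema
open import Data.List.Extrema.Nat using (max; xs≤max; argmax-sel)
open import Data.List.Membership.Propositional using (_∈_)
open import Data.List.Membership.Propositional.Properties
  using (∈-filter⁺; ∈-filter⁻; ∈-upTo⁺; ∈-upTo⁻; ∈-map⁺; ∈-map⁻; ∈-cartesianProductWith⁺)
open import Data.List.Properties
  using (length-map; length-take; length-drop; length-filter; take-map; drop-map; map-id)
open import Data.List.Relation.Binary.Lex.Core using (this; next; halt)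
open import Data.List.Relation.Binary.Prefix.Heterogeneous using (Prefix; []; _∷_)
open import Data.List.Relation.Unary.All as All using (All; []; _∷_)
open import Data.List.Relation.Unary.All.Properties using (drop⁺; take⁺)
open import Data.List.Relation.Unary.Any using (here; there)
open import Data.Nat.Base
open import Data.Nat.DivMod
open import Data.Nat.Divisibility using (n∣m*n)
open import Data.Nat.Induction using (<-rec)
open import Data.Nat.Logarithm using (⌊log₂_⌋; ⌊log₂⌋-mono-≤; ⌊log₂[2^n]⌋≡n)
open import Data.Nat.Properties
open import Data.Nat.Tactic.RingSolver using (solve-∀)
open import Data.Product.Base using (Σ-syntax; ∃-syntax; ∃₂; _×_; _,_; proj₁; proj₂)
open import Data.Rational.Base as ℚ using (ℚ; 0ℚ)
import Data.Rational.Properties as ℚ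
open import Data.Rational.Unnormalised.Base using (mkℚᵘ; *≤*)
import Data.Rational.Unnormalised.Properties as ℚᵘ
open import Data.Sum.Base using (_⊎_; inj₁; inj₂)
open import Data.Vec.Base as Vec using (Vec; []; _∷_; tabulate; toList)
open import Data.Vec.Properties using (toList-map; length-toList)
open import Function.Base using (id; _∘_; case_of_)
open import Level using (0ℓ)
open import Relation.Binary.Bundles using (StrictTotalOrder; DecTotalOrder)
open import Relation.Binary.Definitions using (tri<; tri≈; tri>)
open import Relation.Binary.PropositionalEquality hiding (resp; [_])
open import Relation.Nullary using (¬_; Dec; yes; no; contradiction)
open import Relation.Unary using (Pred; Decidable)
open import Defs

-- Phrase lengths enter only through `IsLZ` and `IsPLCP`, stated for number codes of strings. These
-- specifications determine the lengths, so replacing letters by their ranks preserves both phrase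
-- counts, and the maximum over all alphabets becomes one over finitely many strings. In the upper
-- bound, two suffixes that correspond under a shift by less than ℓ may compare either way. One
-- outcome contradicts a phrase directly, the other only after letters have been prepended to both
-- suffixes; this is why the window reaches ℓ to the left of its phrase. In the lower bound, the
-- separator is the smallest letter. A suffix that agrees for too long outlasts the row, so it is
-- the larger one and no witness for the LCP. The cheap passage between rows comes from Cassini's
-- identity `x * x ≡ 1` modulo `N`: moving by `x` positions raises the value by 1, except where it
-- would reach `N`. The first row has no source and costs about `N` phrases, so at least `N` rows
-- are taken. This keeps `N` below the square root of n, while log `N` still has the order of log n.

record Agree (s : ℕ → ℕ) (p q k : ℕ) : Set where
  constructor agree
  field same : ∀ j → j < k → s (p + j) ≡ s (q + j)

open Agree

record Less (s : ℕ → ℕ) (p q : ℕ) : Set where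
  constructor less
  field
    mismatch : ℕ
    agreed   : Agree s p q mismatch
    below    : s (p + mismatch) < s (q + mismatch)

open Less

-- A string of length n is encoded by a function that is positive exactly below
-- n, so that the value 0 acts as an end marker smaller than every letter.
record IsCode (s : ℕ → ℕ) (n : ℕ) : Set where
  field
    positive : ∀ {i} → i < n → 0 < s i
    beyond   : ∀ {i} → n ≤ i → s i ≡ 0

-- These properties determine `len` on `[0, n)`, so parsings over different alphabets are compared
-- without comparing the algorithms. A fresh letter falls under `len b ≡ 1`.
record IsLZ (s : ℕ → ℕ) (n : ℕ) (len : ℕ → ℕ) : Set where
  field
    nonempty : ∀ {b} → b < n → 0 < len b
    inside   : ∀ {b} → b < n → b + len b ≤ n
    copied   : ∀ {b} → b < n → len b ≡ 1 ⊎ (∃[ p ] p < b × Agree s p b (len b))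
    longest  : ∀ {b p ℓ} → p < b → b + ℓ ≤ n → Agree s p b ℓ → ℓ ≤ len b

record IsPLCP (s : ℕ → ℕ) (n : ℕ) (plcp : ℕ → ℕ) : Set where
  field
    attained : ∀ {b} → b < n → 0 < plcp b →
               ∃[ p ] p + plcp b ≤ n × Less s p b × Agree s p b (plcp b)
    greatest : ∀ {b p k} → b < n → p < n → Less s p b → Agree s p b k → k ≤ plcp b

-- Factorizations as runs of starting positions

data Run (n : ℕ) (len : ℕ → ℕ) : ℕ → ℕ → Set where
  stop : ∀ {b} → n ≤ b → Run n len b 0
  step : ∀ {b k} → b < n → Run n len (b + len b) k → Run n len b (suc k)

phrasesFrom-run : ∀ {A : Set} fuel {len} {S : List A} {b} →
                  (∀ {i} → i < length S → 0 < len i) → length S ≤ b + fuel →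
                  Run (length S) len b (length (phrasesFrom fuel len S b))
phrasesFrom-run zero {b = b} _ h = stop (subst (_ ≤_) (+-identityʳ b) h)
phrasesFrom-run (suc fuel) {len} {S} {b} pos h with b <ᵇ length S in eq
... | false = stop (≮⇒≥ λ lt → subst Bool.T eq (<⇒<ᵇ lt))
... | true  = step b<n (phrasesFrom-run fuel pos (≤-trans h (begin
    b + suc fuel       ≡⟨ +-suc b fuel ⟩
    suc b + fuel       ≡⟨ cong (_+ fuel) (+-comm 1 b) ⟩
    b + 1 + fuel       ≤⟨ +-monoˡ-≤ fuel (+-monoʳ-≤ b (pos b<n)) ⟩
    b + len b + fuel   ∎)))
  where
  open ≤-Reasoning
  b<n : b < length S
  b<n = <ᵇ⇒< b (length S) (subst Bool.T (sym eq) _)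

factorize-run : ∀ {A : Set} {len} (S : List A) → (∀ {i} → i < length S → 0 < len i) →
                Run (length S) len 0 (length (factorize len S))
factorize-run S pos = phrasesFrom-run (length S) pos ≤-refl

-- A run of `k` phrases has `suc k` boundaries, the last being the position where it stops.
boundary : ∀ {n len b k} → Run n len b k → Fin (suc k) → ℕ
boundary {b = b} _          zero    = b
boundary         (step _ r) (suc i) = boundary r i

phraseStart : ∀ {n len b k} → Run n len b k → Fin k → ℕ
phraseStart r i = boundary r (inject₁ i)

boundary-suc : ∀ {n len b k} (r : Run n len b k) i →
               boundary r (suc i) ≡ phraseStart r i + len (phraseStart r i)
boundary-suc (step _ (stop _))   zero    = refl
boundary-suc (step _ (step _ _)) zero    = refl
boundary-suc (step _ r)          (suc i) = boundary-suc r i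

phraseStart<n : ∀ {n len b k} (r : Run n len b k) i → phraseStart r i < n
phraseStart<n (step b<n _) zero    = b<n
phraseStart<n (step _ r)   (suc i) = phraseStart<n r i

boundary≥ : ∀ {n len b k} (r : Run n len b k) i → b ≤ boundary r i
boundary≥ r          zero    = ≤-refl
boundary≥ (step _ r) (suc i) = ≤-trans (m≤m+n _ _) (boundary≥ r i)

phraseStart-gap : ∀ {n len b k} (r : Run n len b k) {i j} → i Fin.< j →
                  phraseStart r i + len (phraseStart r i) ≤ phraseStart r j
phraseStart-gap (step _ r) {zero}  {suc j} _         = boundary≥ r (inject₁ j)
phraseStart-gap (step _ r) {suc i} {suc j} (s≤s i<j) = phraseStart-gap r i<j

covered : ∀ {n len b k} (r : Run n len b k) {q} → b ≤ q → q < n →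
          ∃[ i ] phraseStart r i ≤ q × q < phraseStart r i + len (phraseStart r i)
covered (stop n≤b) b≤q q<n = contradiction (≤-trans n≤b b≤q) (<⇒≱ q<n)
covered {len = len} {b} (step _ r) {q} b≤q q<n with q <? b + len b
... | yes q<e = zero , b≤q , q<e
... | no  q≮e with i , le , lt ← covered r (≮⇒≥ q≮e) q<n = suc i , le , lt

-- Agreement and order of suffixes

Agree-sym : ∀ {s p q k} → Agree s p q k → Agree s q p k
Agree-sym a = agree λ j j<k → sym (same a j j<k)

Agree-trans : ∀ {s p q r k} → Agree s p q k → Agree s q r k → Agree s p r k
Agree-trans a a′ = agree λ j j<k → trans (same a j j<k) (same a′ j j<k)

Agree-≤ : ∀ {s p q k l} → l ≤ k → Agree s p q k → Agree s p q l
Agree-≤ l≤k a = agree λ j j<l → same a j (<-≤-trans j<l l≤k)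

Agree-+ : ∀ {s p q k} d {l} → d + l ≤ k → Agree s p q k → Agree s (p + d) (q + d) l
Agree-+ {s} {p} {q} d d+l≤k a = agree λ j j<l → begin
  s (p + d + j)   ≡⟨ cong s (+-assoc p d j) ⟩
  s (p + (d + j)) ≡⟨ same a (d + j) (<-≤-trans (+-monoʳ-< d j<l) d+l≤k) ⟩
  s (q + (d + j)) ≡⟨ cong s (+-assoc q d j) ⟨
  s (q + d + j)   ∎
  where open ≡-Reasoning

Agree⇒≤mismatch : ∀ {s p q k} (l : Less s p q) → Agree s p q k → k ≤ mismatch l
Agree⇒≤mismatch l a = ≮⇒≥ λ m<k → <⇒≢ (below l) (same a (mismatch l) m<k)

Less-+ : ∀ {s p q} d → Agree s p q d → Less s p q → Less s (p + d) (q + d)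
Less-+ {s} {p} {q} d a l@(less m am lt) =
  less (m ∸ d) (Agree-+ d (≤-reflexive eq) am) (subst₂ _<_ (move p) (move q) lt)
  where
  eq : d + (m ∸ d) ≡ m
  eq = m+[n∸m]≡n (Agree⇒≤mismatch l a)
  move : ∀ x → s (x + m) ≡ s (x + d + (m ∸ d))
  move x = cong s (trans (cong (x +_) (sym eq)) (sym (+-assoc x d (m ∸ d))))

Less-∸ : ∀ {s p q} d → Agree s p q d → Less s (p + d) (q + d) → Less s p q
Less-∸ {s} {p} {q} d a (less m am lt) =
  less (d + m) (agree agr) (subst₂ _<_ (move p) (move q) lt)
  where
  move : ∀ x → s (x + d + m) ≡ s (x + (d + m))
  move x = cong s (+-assoc x d m)
  agr : ∀ j → j < d + m → s (p + j) ≡ s (q + j)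
  agr j j<d+m with j <? d
  ... | yes j<d = same a j j<d
  ... | no  j≮d = begin
    s (p + j)             ≡⟨ shift p ⟩
    s (p + d + (j ∸ d))   ≡⟨ same am (j ∸ d) (subst (j ∸ d <_) (m+n∸m≡n d m) (∸-monoˡ-< j<d+m d≤j)) ⟩
    s (q + d + (j ∸ d))   ≡⟨ shift q ⟨
    s (q + j)             ∎
    where
    open ≡-Reasoning
    d≤j = ≮⇒≥ j≮d
    shift : ∀ x → s (x + j) ≡ s (x + d + (j ∸ d))
    shift x = cong s (trans (cong (x +_) (sym (m+[n∸m]≡n d≤j))) (sym (+-assoc x d (j ∸ d))))

Less-irrefl : ∀ {s p} → ¬ Less s p p
Less-irrefl l = <-irrefl refl (below l)

Less-asym : ∀ {s p q} → Less s p q → ¬ Less s q p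
Less-asym l@(less k a lt) l′@(less k′ a′ lt′)
  with refl ← ≤-antisym (Agree⇒≤mismatch l′ (Agree-sym a)) (Agree⇒≤mismatch l (Agree-sym a′))
  = <-asym lt lt′

module _ {s n} (isCode : IsCode s n) where
  open IsCode isCode

  -- Where the later suffix meets the end marker 0, the earlier one is still inside the string and
  -- has a positive code.
  Agree⇒inside : ∀ {p q k} → p < q → q ≤ n → Agree s p q k → q + k ≤ n
  Agree⇒inside {p} {q} {k} p<q q≤n a = ≮⇒≥ λ n<q+k →
    let j   = n ∸ q
        q+j = m+[n∸m]≡n q≤n
        j<k = +-cancelˡ-< q j k (subst (_< q + k) (sym q+j) n<q+k)
        p+j<n = subst (p + j <_) q+j (+-monoˡ-< j p<q)
    in <⇒≢ (positive p+j<n) (sym (trans (same a j j<k) (trans (cong s q+j) (beyond ≤-refl))))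

  private
    compare-below : ∀ p q m → Agree s p q m ⊎ (Less s p q ⊎ Less s q p)
    compare-below p q zero = inj₁ (agree λ _ ())
    compare-below p q (suc m) with compare-below p q m
    ... | inj₂ l = inj₂ l
    ... | inj₁ a with <-cmp (s (p + m)) (s (q + m))
    ...   | tri< lt _ _ = inj₂ (inj₁ (less m a lt))
    ...   | tri> _ _ gt = inj₂ (inj₂ (less m (Agree-sym a) gt))
    ...   | tri≈ _ eq _ = inj₁ (agree agr)
      where
      agr : ∀ j → j < suc m → s (p + j) ≡ s (q + j)
      agr j j<1+m with m<1+n⇒m<n∨m≡n j<1+m
      ... | inj₁ j<m  = same a j j<m
      ... | inj₂ refl = eq

  Less-total : ∀ {p q} → p < q → q ≤ n → Less s p q ⊎ Less s q p
  -- By `Agree⇒inside`, distinct suffixes cannot agree on `suc n` positions, so a comparison of that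
  -- length is decisive.
  Less-total {p} {q} p<q q≤n with compare-below p q (suc n)
  ... | inj₂ l = l
  ... | inj₁ a = contradiction (≤-trans (m≤n+m (suc n) q) (Agree⇒inside p<q q≤n a)) (<⇒≱ ≤-refl)

  Less-connex : ∀ {p q} → p ≢ q → p ≤ n → q ≤ n → Less s p q ⊎ Less s q p
  Less-connex {p} {q} p≢q p≤n q≤n with <-cmp p q
  ... | tri< p<q _ _ = Less-total p<q q≤n
  ... | tri≈ _ p≡q _ = contradiction p≡q p≢q
  ... | tri> _ _ q<p with Less-total q<p p≤n
  ...   | inj₁ l = inj₂ l
  ...   | inj₂ l = inj₁ l

-- Upper bound

scale : ∀ l → 0 < l → ∃[ σ ] 2 ^ σ ≤ l × l < 2 ^ suc σ
scale (suc zero)    _ = 0 , ≤-refl , ≤-refl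
scale (suc (suc l)) _ with scale (suc l) (s≤s z≤n)
... | σ , lo , hi with suc (suc l) <? 2 ^ suc σ
...   | yes lt = σ , m≤n⇒m≤1+n lo , lt
...   | no  ge = suc σ , ≮⇒≥ ge , ≤-<-trans hi (^-monoʳ-< 2 ≤-refl {suc σ} ≤-refl)

scale≤log : ∀ {σ l n} → 2 ^ σ ≤ l → l ≤ n → σ ≤ ⌊log₂ n ⌋
scale≤log {σ} lo l≤n =
  subst (_≤ _) (⌊log₂[2^n]⌋≡n σ) (⌊log₂⌋-mono-≤ (≤-trans lo l≤n))

module UpperBound {s n lz plcp z v} (isCode : IsCode s n) (isLZ : IsLZ s n lz) (isPLCP : IsPLCP s n plcp)
  (lzRun : Run n lz 0 z) (lexRun : Run n (λ b → plcp b ⊔ 1) 0 v) where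

  open IsCode isCode
  open IsLZ isLZ
  open IsPLCP isPLCP

  -- A window that meets no boundary lies inside one LZ phrase, strictly after its start, so the
  -- source of that phrase contains an earlier copy of it; the descent to the left must stop. A
  -- window that overhangs the string meets the final boundary.
  find-boundary : ∀ {k} → 0 < k → ∀ q → q < n →
                  ∃₂ λ q′ i → q′ ≤ boundary lzRun i × boundary lzRun i < q′ + k × Agree s q′ q k
  find-boundary {k} 0<k = <-rec _ λ q rec q<n → search q rec q<n (covered lzRun z≤n q<n)
    where
    Goal : ℕ → Set
    Goal q = ∃₂ λ q′ i → q′ ≤ boundary lzRun i × boundary lzRun i < q′ + k × Agree s q′ q k
    search : ∀ q → (∀ {q′} → q′ < q → q′ < n → Goal q′) → q < n →
             (∃[ i ] phraseStart lzRun i ≤ q × q < phraseStart lzRun i + lz (phraseStart lzRun i)) → Goal q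
    search q rec q<n (i , b≤q , q<e) with m≤n⇒m<n∨m≡n b≤q
    ... | inj₂ b≡q = q , inject₁ i , ≤-reflexive (sym b≡q)
                   , subst (_< q + k) (sym b≡q) (m<m+n q 0<k) , agree (λ _ _ → refl)
    ... | inj₁ b<q with phraseStart lzRun i + lz (phraseStart lzRun i) <? q + k
    ...   | yes e<q+k rewrite sym (boundary-suc lzRun i) =
      q , suc i , <⇒≤ q<e , e<q+k , agree (λ _ _ → refl)
    ...   | no  e≮q+k with copied (phraseStart<n lzRun i)
    ...     | inj₁ len≡1 =
      let e≡1+b = trans (cong (phraseStart lzRun i +_) len≡1) (+-comm (phraseStart lzRun i) 1)
      in contradiction (≤-trans b<q (s≤s⁻¹ (subst (q <_) e≡1+b q<e))) (<⇒≱ ≤-refl)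
    ...     | inj₂ (p , p<b , a) =
      let b     = phraseStart lzRun i
          d     = q ∸ b
          b+d≡q = m+[n∸m]≡n b≤q
          p+d<q = subst (p + d <_) b+d≡q (+-monoˡ-< d p<b)
          d+k≤  = +-cancelˡ-≤ b (d + k) (lz b)
                    (subst (_≤ b + lz b) (trans (cong (_+ k) (sym b+d≡q)) (+-assoc b d k)) (≮⇒≥ e≮q+k))
          q′ , i′ , le , lt , a′ = rec p+d<q (<-trans p+d<q q<n)
      in q′ , i′ , le , lt , Agree-trans a′ (subst (λ x → Agree s (p + d) x k) b+d≡q (Agree-+ d d+k≤ a))

  -- Put `b = a + ℓ` and `b′ = a′ + ℓ`. As the copies start `d` apart, the suffix at `b + d` agrees
  -- with that at `b′` for `2ℓ` letters, and the suffix at `b` with that at `b′ - d = a′ + u` for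
  -- `3ℓ`. If `b + d` has the smaller suffix, the value of `plcp` at `b′` is too small. Otherwise
  -- prepending `d` common letters makes the suffix at `b′ - d` smaller than that at `b`, and the
  -- value at `b` is too small.
  clash : ∀ {q a a′ d u ℓ} → u + d ≡ ℓ → 0 < ℓ → a + ℓ < n → a′ + ℓ < n → a + ℓ + d ≢ a′ + ℓ →
          plcp (a + ℓ) < 2 * ℓ → plcp (a′ + ℓ) < 2 * ℓ →
          Agree s q a (4 * ℓ) → Agree s (q + d) a′ (4 * ℓ) → ⊥
  clash {q} {a} {a′} {d} {u} {ℓ} refl 0<ℓ b<n b′<n apart short short′ A A′ =
    case Less-connex isCode apart (<⇒≤ shifted<n) (<⇒≤ b′<n) of λ where
      (inj₁ l) → <⇒≱ short′ (greatest b′<n shifted<n l shifted)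
      (inj₂ l) → <⇒≱ short (≤-trans (*-monoˡ-≤ ℓ (n≤1+n 2))
                   (greatest b<n b′-d<n
                     (Less-∸ d (Agree-≤ (≤-trans (m≤n+m d u) (m≤m+n ℓ _)) unshifted)
                       (subst (λ x → Less s x (a + ℓ + d)) (sym (+-assoc a′ u d)) l))
                     unshifted))
    where
    unshifted : Agree s (a′ + u) (a + ℓ) (3 * ℓ)
    unshifted = Agree-trans
      (Agree-sym (subst (λ x → Agree s x (a′ + u) (3 * ℓ))
        (trans (+-assoc q d u) (cong (q +_) (+-comm d u)))
        (Agree-+ u (≤-trans (+-monoˡ-≤ (3 * ℓ) (m≤m+n u d)) ≤-refl) A′)))
      (Agree-+ ℓ ≤-refl A)
    b′-d<n : a′ + u < n
    b′-d<n = ≤-<-trans (+-monoʳ-≤ a′ (m≤m+n u d)) b′<n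
    shifted : Agree s (a + ℓ + d) (a′ + ℓ) (2 * ℓ)
    shifted = subst (λ x → Agree s x (a′ + ℓ) (2 * ℓ)) swap
      (Agree-+ ℓ ≤-refl (Agree-trans (Agree-sym (Agree-+ d (+-monoˡ-≤ (3 * ℓ) (m≤n+m d u)) A))
                                     (Agree-≤ (m≤n+m (3 * ℓ) ℓ) A′)))
      where
      swap : a + d + ℓ ≡ a + ℓ + d
      swap = trans (+-assoc a d ℓ) (trans (cong (a +_) (+-comm d ℓ)) (sym (+-assoc a ℓ d)))
    shifted<n : a + ℓ + d < n
    shifted<n = ≰⇒> λ n≤ → <⇒≢ (positive b′<n) (begin
      0                  ≡⟨ beyond n≤ ⟨
      s (a + ℓ + d)      ≡⟨ cong s (+-identityʳ _) ⟨
      s (a + ℓ + d + 0)  ≡⟨ same shifted 0 (<-≤-trans 0<ℓ (m≤m+n ℓ _)) ⟩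
      s (a′ + ℓ + 0)     ≡⟨ cong s (+-identityʳ _) ⟩
      s (a′ + ℓ)         ∎)
      where open ≡-Reasoning

  -- A phrase of length in [ℓ, 2ℓ) starting at b is charged to a boundary of the
  -- LZ parsing met by some copy of the window [b − ℓ, b + 3ℓ), and to the position
  -- of that boundary in the copy, rounded down to a multiple of ℓ.
  data Charge (b ℓ : ℕ) : Fin (suc z) → Fin 5 → Set where
    early  : b < ℓ → Charge b ℓ zero zero
    window : ∀ {a q i c} → a + ℓ ≡ b → q ≤ boundary lzRun i → Agree s q a (4 * ℓ) →
             toℕ c * ℓ ≤ boundary lzRun i ∸ q → boundary lzRun i ∸ q < suc (toℕ c) * ℓ →
             Charge b ℓ i (suc c)

  charge : ∀ {b} ℓ .{{_ : NonZero ℓ}} → b < n → ∃₂ (Charge b ℓ)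
  charge {b} ℓ b<n with b <? ℓ
  ... | yes b<ℓ = zero , zero , early b<ℓ
  ... | no  b≮ℓ = i , suc c , window (m∸n+n≡m (≮⇒≥ b≮ℓ)) q≤e a lo hi
    where
    found = find-boundary {4 * ℓ} (≤-trans (>-nonZero⁻¹ ℓ) (m≤m+n ℓ _)) (b ∸ ℓ) (≤-<-trans (m∸n≤m b ℓ) b<n)
    q = proj₁ found
    i = proj₁ (proj₂ found)
    q≤e = proj₁ (proj₂ (proj₂ found))
    e<  = proj₁ (proj₂ (proj₂ (proj₂ found)))
    a   = proj₂ (proj₂ (proj₂ (proj₂ found)))
    x = boundary lzRun i ∸ q
    -- The window has length `4 * ℓ`, which gives four bins of width `ℓ`; the fifth element of
    -- `Fin 5` is for `early`.
    x/ℓ<4 : x / ℓ < 4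
    x/ℓ<4 = m<n*o⇒m/o<n (subst (x <_) (m+n∸m≡n q (4 * ℓ)) (∸-monoˡ-< e< q≤e))
    c = fromℕ< x/ℓ<4
    lo : toℕ c * ℓ ≤ x
    lo rewrite Fin.toℕ-fromℕ< x/ℓ<4 = m/n*n≤m x ℓ
    hi : x < suc (toℕ c) * ℓ
    hi rewrite Fin.toℕ-fromℕ< x/ℓ<4 =
      subst (_< suc (x / ℓ) * ℓ) (sym (m≡m%n+[m/n]*n x ℓ)) (+-monoˡ-< (x / ℓ * ℓ) (m%n<n x ℓ))

  private
    bin-close : ∀ {e q q′} c {ℓ} → q ≤ e → q′ ≤ e → c * ℓ ≤ e ∸ q′ → e ∸ q < suc c * ℓ → q′ < q + ℓ
    bin-close {e} {q} {q′} c {ℓ} q≤e q′≤e lo hi = +-cancelʳ-< (c * ℓ) q′ (q + ℓ) (begin-strict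
      q′ + c * ℓ     ≤⟨ +-monoʳ-≤ q′ lo ⟩
      q′ + (e ∸ q′)  ≡⟨ m+[n∸m]≡n q′≤e ⟩
      e              ≡⟨ m+[n∸m]≡n q≤e ⟨
      q + (e ∸ q)    <⟨ +-monoʳ-< q hi ⟩
      q + (ℓ + c * ℓ) ≡⟨ +-assoc q ℓ (c * ℓ) ⟨
      q + ℓ + c * ℓ  ∎)
      where open ≤-Reasoning

  -- Offsets to the same boundary in the same bin put the copies less than `ℓ` apart, so `clash`
  -- applies with the left copy in the role of `q`. The distance between the phrases ensures that
  -- the two suffixes compared there are distinct.
  charge-injective : ∀ {b b′ ℓ i c} .{{_ : NonZero ℓ}} → b < n → b′ < n → b + ℓ ≤ b′ →
    plcp b < 2 * ℓ → plcp b′ < 2 * ℓ → Charge b ℓ i c → Charge b′ ℓ i c → ⊥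
  -- Starting positions at one scale are at least `ℓ` apart, so only one of them is below `ℓ`.
  charge-injective {b} {b′} {ℓ} _ _ far _ _ (early _) (early b′<ℓ) =
    <⇒≱ b′<ℓ (≤-trans (m≤n+m ℓ b) far)
  charge-injective {ℓ = ℓ} b<n b′<n far short short′
    (window {a} {q} {c = c} refl q≤e A lo hi) (window {a′} {q′} refl q′≤e A′ lo′ hi′) with ≤-total q q′
  ... | inj₁ q≤q′ = clash {d = d} (m∸n+n≡m (<⇒≤ d<ℓ)) (>-nonZero⁻¹ ℓ) b<n b′<n
        (<⇒≢ (<-≤-trans (+-monoʳ-< (a + ℓ) d<ℓ) far)) short short′ A
        (subst (λ x → Agree s x a′ (4 * ℓ)) (sym (m+[n∸m]≡n q≤q′)) A′)
    where
    d = q′ ∸ q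
    d<ℓ : d < ℓ
    d<ℓ = subst (d <_) (m+n∸m≡n q ℓ) (∸-monoˡ-< (bin-close (toℕ c) q≤e q′≤e lo′ hi) q≤q′)
  ... | inj₂ q′≤q = clash {d = d} (m∸n+n≡m (<⇒≤ d<ℓ)) (>-nonZero⁻¹ ℓ) b′<n b<n
        (λ eq → <⇒≢ (<-≤-trans (m<m+n (a + ℓ) (>-nonZero⁻¹ ℓ)) (≤-trans far (m≤m+n (a′ + ℓ) d))) (sym eq))
        short′ short A′
        (subst (λ x → Agree s x a (4 * ℓ)) (sym (m+[n∸m]≡n q′≤q)) A)
    where
    d = q ∸ q′
    d<ℓ : d < ℓ
    d<ℓ = subst (d <_) (m+n∸m≡n q′ ℓ) (∸-monoˡ-< (bin-close (toℕ c) q′≤e q≤e lo hi′) q′≤q)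

  private
    start = phraseStart lexRun
    size  = λ i → plcp (start i) ⊔ 1

    size>0 : ∀ i → 0 < size i
    size>0 i = m≤n⊔m (plcp (start i)) 1

    σ : ∀ i → ∃[ σ ] 2 ^ σ ≤ size i × size i < 2 ^ suc σ
    σ i = scale (size i) (size>0 i)

    size≤n : ∀ i → size i ≤ n
    size≤n i with plcp (start i) in eq | phraseStart<n lexRun i
    ... | zero  | b<n = ≤-trans (s≤s z≤n) b<n
    ... | suc l | b<n with p , p+l≤n , _ ← attained b<n (subst (0 <_) (sym eq) (s≤s z≤n)) =
      subst (_≤ n) (trans eq (cong suc (sym (⊔-identityʳ l)))) (≤-trans (m≤n+m _ p) p+l≤n)

    2^σ : Fin v → ℕ
    2^σ i = 2 ^ proj₁ (σ i)

    charged : ∀ i → ∃₂ (Charge (start i) (2^σ i))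
    charged i = charge (2^σ i) {{m^n≢0 2 (proj₁ (σ i))}} (phraseStart<n lexRun i)

    σ<1+log : ∀ i → proj₁ (σ i) < suc ⌊log₂ n ⌋
    σ<1+log i = s≤s (scale≤log {proj₁ (σ i)} (proj₁ (proj₂ (σ i))) (size≤n i))

    level : Fin v → Fin (suc ⌊log₂ n ⌋)
    level i = fromℕ< (σ<1+log i)

    place : Fin v → Fin (suc z)
    place i = proj₁ (charged i)

    bin : Fin v → Fin 5
    bin i = proj₁ (proj₂ (charged i))

    index : Fin v → Fin (suc ⌊log₂ n ⌋ * (suc z * 5))
    index i = combine (level i) (combine (place i) (bin i))

    plcp<2^1+σ : ∀ i → plcp (start i) < 2 * 2^σ i
    plcp<2^1+σ i = ≤-<-trans (m≤m⊔n _ 1) (proj₂ (proj₂ (σ i)))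

    index-distinct : ∀ {i j} → i Fin.< j → index i ≢ index j
    index-distinct {i} {j} i<j eq
      with eqσ , eqc ← Fin.combine-injective (level i) (combine (place i) (bin i))
                                             (level j) (combine (place j) (bin j)) eq
      with eqe , eqb ← Fin.combine-injective (place i) (bin i) (place j) (bin j) eqc =
      charge-injective {{m^n≢0 2 (proj₁ (σ i))}} (phraseStart<n lexRun i) (phraseStart<n lexRun j)
        (≤-trans (+-monoʳ-≤ (start i) (proj₁ (proj₂ (σ i)))) (phraseStart-gap lexRun i<j))
        (plcp<2^1+σ i)
        (subst (λ m → plcp (start j) < 2 * m) (sym ℓ≡) (plcp<2^1+σ j))
        (subst₂ (Charge (start i) (2^σ i)) eqe eqb (proj₂ (proj₂ (charged i))))
        (subst (λ m → Charge (start j) m (place j) (bin j)) (sym ℓ≡) (proj₂ (proj₂ (charged j))))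
      where
      ℓ≡ : 2^σ i ≡ 2^σ j
      ℓ≡ = cong (2 ^_) (trans (sym (Fin.toℕ-fromℕ< (σ<1+log i))) (trans (cong toℕ eqσ) (Fin.toℕ-fromℕ< (σ<1+log j))))

    index-injective : ∀ {i j} → index i ≡ index j → i ≡ j
    index-injective {i} {j} eq with Fin.<-cmp i j
    ... | tri< i<j _ _ = contradiction eq (index-distinct i<j)
    ... | tri≈ _ i≡j _ = i≡j
    ... | tri> _ _ j<i = contradiction (sym eq) (index-distinct j<i)

  lex≤lz*log : v ≤ suc ⌊log₂ n ⌋ * (suc z * 5)
  lex≤lz*log = Fin.injective⇒≤ index-injective

-- Strings over arbitrary alphabets as codes

code : List ℕ → ℕ → ℕ
code []       _       = 0
code (x ∷ _)  zero    = suc x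
code (_ ∷ xs) (suc i) = code xs i

code-drop : ∀ b xs j → code (drop b xs) j ≡ code xs (b + j)
code-drop zero    xs       j = refl
code-drop (suc b) []       j = refl
code-drop (suc b) (_ ∷ xs) j = code-drop b xs j

code-take : ∀ {ℓ} xs {j} → j < ℓ → code (take ℓ xs) j ≡ code xs j
code-take []       {j}     (s≤s _) = refl
code-take (_ ∷ xs) {zero}  (s≤s _) = refl
code-take (_ ∷ xs) {suc j} (s≤s h) = code-take xs h

code-positive : ∀ xs {i} → i < length xs → 0 < code xs i
code-positive (_ ∷ _)  {zero}  _       = s≤s z≤n
code-positive (_ ∷ xs) {suc i} (s≤s h) = code-positive xs h

code-beyond : ∀ xs {i} → length xs ≤ i → code xs i ≡ 0
code-beyond []       _       = refl
code-beyond (_ ∷ xs) (s≤s h) = code-beyond xs h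

max-sel : ∀ xs → max 0 xs ≡ 0 ⊎ max 0 xs ∈ xs
max-sel = argmax-sel id 0

module _ (Σ : Alphabet) where
  open StrictTotalOrder Σ using (_≈_) renaming (Carrier to Letter; _<_ to _≺_; _≟_ to _≈?_; compare to ≺-compare)

  -- Only the letters of `S` are constrained: an arbitrary total order need not embed into `ℕ`, but
  -- the finitely many letters of a string do.
  record Embeds (S : List Letter) (r : Letter → ℕ) : Set where
    field
      resp : ∀ {x y} → x ∈ S → y ∈ S → x ≈ y → r x ≡ r y
      mono : ∀ {x y} → x ∈ S → y ∈ S → x ≺ y → r x < r y

    injective : ∀ {x y} → x ∈ S → y ∈ S → r x ≡ r y → x ≈ y
    injective {x} {y} x∈ y∈ eq with ≺-compare x y
    ... | tri< lt _ _ = contradiction eq (<⇒≢ (mono x∈ y∈ lt))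
    ... | tri≈ _ e _  = e
    ... | tri> _ _ gt = contradiction (sym eq) (<⇒≢ (mono y∈ x∈ gt))

    reflects : ∀ {x y} → x ∈ S → y ∈ S → r x < r y → x ≺ y
    reflects {x} {y} x∈ y∈ rx<ry with ≺-compare x y
    ... | tri< lt _ _ = lt
    ... | tri≈ _ e _  = contradiction (resp x∈ y∈ e) (<⇒≢ rx<ry)
    ... | tri> _ _ gt = contradiction (mono y∈ x∈ gt) (<-asym rx<ry)

  module Encoding {S : List Letter} {r : Letter → ℕ} (embeds : Embeds S r) where
    open Embeds embeds
    open Parsing Σ

    private
      n = length S

      ⟦_⟧ : List Letter → ℕ → ℕ
      ⟦ X ⟧ = code (map r X)

      SameUpTo : ℕ → List Letter → List Letter → Set
      SameUpTo k X Y = ∀ j → j < k → ⟦ X ⟧ j ≡ ⟦ Y ⟧ j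

    s : ℕ → ℕ
    s = ⟦ S ⟧

    isCode : IsCode s n
    isCode = record
      { positive = λ i<n → code-positive (map r S) (subst (_ <_) (sym (length-map r S)) i<n)
      ; beyond   = λ n≤i → code-beyond (map r S) (subst (_≤ _) (sym (length-map r S)) n≤i)
      }

    private
      members : All (_∈ S) S
      members = All.tabulate id

      suffix∈ : ∀ b → All (_∈ S) (drop b S)
      suffix∈ b = drop⁺ b members

      ⟦drop⟧ : ∀ b j → ⟦ drop b S ⟧ j ≡ s (b + j)
      ⟦drop⟧ b j = trans (cong (λ l → code l j) (sym (drop-map b S))) (code-drop b (map r S) j)

      ⟦take⟧ : ∀ {ℓ} X {j} → j < ℓ → ⟦ take ℓ X ⟧ j ≡ ⟦ X ⟧ j
      ⟦take⟧ {ℓ} X {j} j<ℓ = trans (cong (λ l → code l j) (sym (take-map ℓ X))) (code-take (map r X) j<ℓ)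

      same⇒agree : ∀ {p q k} → SameUpTo k (drop p S) (drop q S) → Agree s p q k
      same⇒agree {p} {q} h = agree λ j j<k → trans (sym (⟦drop⟧ p j)) (trans (h j j<k) (⟦drop⟧ q j))

      agree⇒same : ∀ {p q k} → Agree s p q k → SameUpTo k (drop p S) (drop q S)
      agree⇒same {p} {q} a j j<k = trans (⟦drop⟧ p j) (trans (same a j j<k) (sym (⟦drop⟧ q j)))

      lcp-same : ∀ X Y → All (_∈ S) X → All (_∈ S) Y → SameUpTo (lcp X Y) X Y
      lcp-same (x ∷ X) (y ∷ Y) (x∈ ∷ X∈) (y∈ ∷ Y∈) with x ≈? y
      ... | no  _   = λ _ ()
      ... | yes x≈y = λ where
        zero    _       → cong suc (resp x∈ y∈ x≈y)
        (suc j) (s≤s h) → lcp-same X Y X∈ Y∈ j h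

      lcp-max : ∀ {k} X Y → All (_∈ S) X → All (_∈ S) Y → k ≤ length X → k ≤ length Y →
                SameUpTo k X Y → k ≤ lcp X Y
      lcp-max {zero}  _       _       _         _         _       _       _ = z≤n
      lcp-max {suc k} (x ∷ X) (y ∷ Y) (x∈ ∷ X∈) (y∈ ∷ Y∈) (s≤s h) (s≤s i) eq with x ≈? y
      ... | yes _  = s≤s (lcp-max X Y X∈ Y∈ h i λ j j<k → eq (suc j) (s≤s j<k))
      ... | no x≉y = contradiction (injective x∈ y∈ (suc-injective (eq 0 (s≤s z≤n)))) x≉y

      lcp≤lengthʳ : ∀ X Y → lcp X Y ≤ length Y
      lcp≤lengthʳ []      _       = z≤n
      lcp≤lengthʳ (_ ∷ _) []      = z≤n
      lcp≤lengthʳ (x ∷ X) (y ∷ Y) with x ≈? y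
      ... | yes _ = s≤s (lcp≤lengthʳ X Y)
      ... | no  _ = z≤n

      lex⇒ : ∀ {X Y} → All (_∈ S) X → All (_∈ S) Y → X ≺ˡᵉˣ Y →
             ∃[ k ] SameUpTo k X Y × ⟦ X ⟧ k < ⟦ Y ⟧ k
      lex⇒ _ _ halt = 0 , (λ _ ()) , s≤s z≤n
      lex⇒ (x∈ ∷ _) (y∈ ∷ _) (this x≺y) = 0 , (λ _ ()) , s≤s (mono x∈ y∈ x≺y)
      lex⇒ (x∈ ∷ X∈) (y∈ ∷ Y∈) (next x≈y l) with k , eq , lt ← lex⇒ X∈ Y∈ l =
        suc k , (λ where zero    _       → cong suc (resp x∈ y∈ x≈y)
                         (suc j) (s≤s h) → eq j h) , lt

      lex⇐ : ∀ {X Y} k → All (_∈ S) X → All (_∈ S) Y → SameUpTo k X Y → ⟦ X ⟧ k < ⟦ Y ⟧ k → X ≺ˡᵉˣ Y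
      lex⇐ {[]}    {_ ∷ _} _       _         _         _  _  = halt
      lex⇐ {_ ∷ _} {_ ∷ _} zero    (x∈ ∷ _)  (y∈ ∷ _)  _  lt = this (reflects x∈ y∈ (s≤s⁻¹ lt))
      lex⇐ {_ ∷ _} {_ ∷ _} (suc k) (x∈ ∷ X∈) (y∈ ∷ Y∈) eq lt =
        next (injective x∈ y∈ (suc-injective (eq 0 (s≤s z≤n))))
             (lex⇐ k X∈ Y∈ (λ j h → eq (suc j) (s≤s h)) lt)

      prefix⇒ : ∀ {X Y} → All (_∈ S) X → All (_∈ S) Y → Prefix _≈_ X Y → SameUpTo (length X) X Y
      prefix⇒ (x∈ ∷ _)  (y∈ ∷ _)  (x≈y ∷ _)  zero    _       = cong suc (resp x∈ y∈ x≈y)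
      prefix⇒ (_  ∷ X∈) (_  ∷ Y∈) (_ ∷ pre) (suc j) (s≤s h) = prefix⇒ X∈ Y∈ pre j h

      prefix⇐ : ∀ {X Y} → All (_∈ S) X → All (_∈ S) Y → SameUpTo (length X) X Y → Prefix _≈_ X Y
      prefix⇐ {[]}             _         _         _  = []
      prefix⇐ {_ ∷ _} {[]}     _         _         eq = case eq 0 (s≤s z≤n) of λ ()
      prefix⇐ {_ ∷ _} {_ ∷ _}  (x∈ ∷ X∈) (y∈ ∷ Y∈) eq =
        injective x∈ y∈ (suc-injective (eq 0 (s≤s z≤n))) ∷ prefix⇐ X∈ Y∈ λ j h → eq (suc j) (s≤s h)

      less⇒ : ∀ {p b} → drop p S ≺ˡᵉˣ drop b S → Less s p b
      less⇒ {p} {b} l with k , eq , lt ← lex⇒ (suffix∈ p) (suffix∈ b) l =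
        less k (same⇒agree eq) (subst₂ _<_ (⟦drop⟧ p k) (⟦drop⟧ b k) lt)

      less⇐ : ∀ {p b} → Less s p b → drop p S ≺ˡᵉˣ drop b S
      less⇐ {p} {b} (less k a lt) = lex⇐ k (suffix∈ p) (suffix∈ b) (agree⇒same a)
        (subst₂ _<_ (sym (⟦drop⟧ p k)) (sym (⟦drop⟧ b k)) lt)

      Less⇒≢ : ∀ {p q} → Less s p q → p ≢ q
      Less⇒≢ l refl = Less-irrefl l

    maxSmallerLCP-isPLCP : IsPLCP s n (maxSmallerLCP S)
    maxSmallerLCP-isPLCP = record { attained = attained ; greatest = greatest }
      where
      lcps : ℕ → List ℕ
      lcps b = map (λ p → lcp (drop b S) (drop p S))
                   (filter (λ p → drop p S ≺ˡᵉˣ? drop b S) (upTo n))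

      attained : ∀ {b} → b < n → 0 < maxSmallerLCP S b →
                 ∃[ p ] p + maxSmallerLCP S b ≤ n × Less s p b × Agree s p b (maxSmallerLCP S b)
      attained {b} b<n pos with max-sel (lcps b)
      ... | inj₁ ≡0 = contradiction (sym ≡0) (<⇒≢ pos)
      ... | inj₂ m∈ with p , p∈ , eq ← ∈-map⁻ (λ p → lcp (drop b S) (drop p S)) m∈
                    with p∈upTo , l ← ∈-filter⁻ (λ p → drop p S ≺ˡᵉˣ? drop b S) p∈ =
        p , subst (λ m → p + m ≤ n) (sym eq)
              (subst (p + lcp (drop b S) (drop p S) ≤_) (m+[n∸m]≡n (<⇒≤ (∈-upTo⁻ p∈upTo)))
                (+-monoʳ-≤ p (subst (lcp (drop b S) (drop p S) ≤_) (length-drop p S)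
                  (lcp≤lengthʳ (drop b S) (drop p S)))))
          , less⇒ l
          , subst (Agree s p b) (sym eq)
              (Agree-sym (same⇒agree (lcp-same (drop b S) (drop p S) (suffix∈ b) (suffix∈ p))))

      -- Codes are total functions, so agreement alone might run past the end of the string, where
      -- `lcp` stops. For distinct positions it does not.
      inside : ∀ {p q k} → p < n → q < n → p ≢ q → Agree s p q k → q + k ≤ n
      inside {p} {q} {k} p<n q<n p≢q a with <-cmp p q
      ... | tri< p<q _ _ = Agree⇒inside isCode p<q (<⇒≤ q<n) a
      ... | tri≈ _ p≡q _ = contradiction p≡q p≢q
      ... | tri> _ _ q<p = ≤-trans (+-monoˡ-≤ k (<⇒≤ q<p))
                             (Agree⇒inside isCode q<p (<⇒≤ p<n) (Agree-sym a))

      fits : ∀ {p k} → p + k ≤ n → k ≤ length (drop p S)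
      fits {p} {k} h = subst (k ≤_) (sym (length-drop p S)) (m+n≤o⇒m≤o∸n k (subst (_≤ n) (+-comm p k) h))

      greatest : ∀ {b p k} → b < n → p < n → Less s p b → Agree s p b k → k ≤ maxSmallerLCP S b
      greatest {b} {p} {k} b<n p<n l a = ≤-trans
        (lcp-max (drop b S) (drop p S) (suffix∈ b) (suffix∈ p)
          (fits (inside p<n b<n (Less⇒≢ l) a))
          (fits (inside b<n p<n (λ eq → Less⇒≢ l (sym eq)) (Agree-sym a)))
          (agree⇒same (Agree-sym a)))
        (All.lookup (xs≤max 0 (lcps b))
          (∈-map⁺ _ (∈-filter⁺ (λ p → drop p S ≺ˡᵉˣ? drop b S) (∈-upTo⁺ p<n) (less⇐ l))))

    private
      length-window : ∀ {b ℓ} → b + ℓ ≤ n → length (take ℓ (drop b S)) ≡ ℓ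
      length-window {b} {ℓ} h = trans (length-take ℓ (drop b S))
        (m≤n⇒m⊓n≡m (subst (ℓ ≤_) (sym (length-drop b S)) (m+n≤o⇒m≤o∸n ℓ (subst (_≤ n) (+-comm b ℓ) h))))

      occurs⇒ : ∀ {b ℓ} → b + ℓ ≤ n → OccursBefore S b (take ℓ (drop b S)) →
                ∃[ p ] p < b × Agree s p b ℓ
      occurs⇒ {b} {ℓ} h (p , p<b , pre) = p , p<b , Agree-sym (same⇒agree λ j j<ℓ →
        trans (sym (⟦take⟧ (drop b S) j<ℓ))
          (prefix⇒ (take⁺ ℓ (suffix∈ b)) (suffix∈ p) pre j (subst (j <_) (sym (length-window h)) j<ℓ)))

      occurs⇐ : ∀ {b ℓ p} → b + ℓ ≤ n → p < b → Agree s p b ℓ → OccursBefore S b (take ℓ (drop b S))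
      occurs⇐ {b} {ℓ} {p} h p<b a = p , p<b , prefix⇐ (take⁺ ℓ (suffix∈ b)) (suffix∈ p) λ j j< →
        let j<ℓ = subst (j <_) (length-window h) j<
        in trans (⟦take⟧ (drop b S) j<ℓ) (agree⇒same (Agree-sym a) j j<ℓ)

    lzLength-isLZ : IsLZ s n (lzLength S)
    lzLength-isLZ = record { nonempty = nonempty ; inside = inside ; copied = copied ; longest = longest }
      where
      occurs? : ∀ b ℓ → Dec (OccursBefore S b (take ℓ (drop b S)))
      occurs? b ℓ = occursBefore? S b (take ℓ (drop b S))

      lengths : ℕ → List ℕ
      lengths b = filter (occurs? b) (upTo (suc (n ∸ b)))

      ∈lengths : ∀ {b ℓ} → b + ℓ ≤ n → OccursBefore S b (take ℓ (drop b S)) → ℓ ∈ lengths b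
      ∈lengths {b} {ℓ} h = ∈-filter⁺ (occurs? b) (∈-upTo⁺ (s≤s (m+n≤o⇒m≤o∸n ℓ (subst (_≤ n) (+-comm b ℓ) h))))

      +1≤n : ∀ {b} → b < n → b + 1 ≤ n
      +1≤n {b} b<n = subst (_≤ n) (+-comm 1 b) b<n

      nonempty : ∀ {b} → b < n → 0 < lzLength S b
      nonempty {b} b<n with occurs? b 1
      ... | no  _   = s≤s z≤n
      ... | yes occ = All.lookup (xs≤max 0 (lengths b)) (∈lengths (+1≤n b<n) occ)

      longest : ∀ {b p ℓ} → p < b → b + ℓ ≤ n → Agree s p b ℓ → ℓ ≤ lzLength S b
      longest {ℓ = zero}  _   _ _ = z≤n
      longest {b} {ℓ = suc ℓ} p<b h a with occurs? b 1
      ... | yes _   = All.lookup (xs≤max 0 (lengths b)) (∈lengths h (occurs⇐ h p<b a))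
      ... | no ¬occ = contradiction
        (occurs⇐ (≤-trans (+-monoʳ-≤ b (s≤s z≤n)) h) p<b (Agree-≤ (s≤s z≤n) a)) ¬occ

      valid : ∀ {b} → b < n → b + lzLength S b ≤ n ×
              (lzLength S b ≡ 1 ⊎ (∃[ p ] p < b × Agree s p b (lzLength S b)))
      valid {b} b<n with occurs? b 1 | nonempty b<n
      ... | no  _ | _   = +1≤n b<n , inj₁ refl
      ... | yes _ | pos with max-sel (lengths b)
      ...   | inj₁ ≡0 = contradiction (sym ≡0) (<⇒≢ pos)
      ...   | inj₂ m∈ with m∈upTo , occ ← ∈-filter⁻ (occurs? b) m∈ = fit , inj₂ (occurs⇒ fit occ)
        where
        fit : b + max 0 (lengths b) ≤ n
        fit = subst (b + max 0 (lengths b) ≤_) (m+[n∸m]≡n (<⇒≤ b<n))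
                (+-monoʳ-≤ b (s≤s⁻¹ (∈-upTo⁻ m∈upTo)))

      inside : ∀ {b} → b < n → b + lzLength S b ≤ n
      inside b<n = proj₁ (valid b<n)

      copied : ∀ {b} → b < n → lzLength S b ≡ 1 ⊎ (∃[ p ] p < b × Agree s p b (lzLength S b))
      copied b<n = proj₂ (valid b<n)

-- Existence of the maximal ratio

IsLZ-unique : ∀ {s n f g b} → IsLZ s n f → IsLZ s n g → b < n → f b ≡ g b
IsLZ-unique {s} {n} F G b<n = ≤-antisym (f≤g F G b<n) (f≤g G F b<n)
  where
  open IsLZ
  f≤g : ∀ {f g b} → IsLZ s n f → IsLZ s n g → b < n → f b ≤ g b
  f≤g {f} {g} {b} F G b<n with copied F b<n
  ... | inj₁ f≡1           = subst (_≤ g b) (sym f≡1) (nonempty G b<n)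
  ... | inj₂ (p , p<b , a) = longest G p<b (inside F b<n) a

IsPLCP-unique : ∀ {s n f g b} → IsPLCP s n f → IsPLCP s n g → b < n → f b ≡ g b
IsPLCP-unique {s} {n} F G b<n = ≤-antisym (f≤g F G b<n) (f≤g G F b<n)
  where
  open IsPLCP
  f≤g : ∀ {f g b} → IsPLCP s n f → IsPLCP s n g → b < n → f b ≤ g b
  f≤g {f} {g} {b} F G b<n with f b in eq
  ... | zero  = z≤n
  ... | suc k with p , p+f≤n , l , a ← attained F b<n (subst (0 <_) (sym eq) (s≤s z≤n)) =
    subst (_≤ g b) eq (greatest G b<n
      (<-≤-trans (m<m+n p (subst (0 <_) (sym eq) (s≤s z≤n))) p+f≤n) l a)

Run-unique : ∀ {n f g b k l} → (∀ {i} → i < n → f i ≡ g i) → Run n f b k → Run n g b l → k ≡ l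
Run-unique eq (stop _)     (stop _)     = refl
Run-unique eq (stop n≤b)   (step b<n _) = contradiction b<n (≤⇒≯ n≤b)
Run-unique eq (step b<n _) (stop n≤b)   = contradiction b<n (≤⇒≯ n≤b)
Run-unique {n} {f} {g} {b} eq (step {k = k} b<n r) (step _ r′) =
  cong suc (Run-unique eq (subst (λ x → Run n f (b + x) k) (eq b<n) r) r′)

ℕ< : Alphabet
ℕ< = <-strictTotalOrder

Embeds-id : ∀ S → Embeds ℕ< S id
Embeds-id S = record { resp = λ _ _ → id ; mono = λ _ _ → id }

module _ (Σ : Alphabet) where
  open Parsing Σ

  module _ {S r} (embeds : Embeds Σ S r) where
    open Encoding Σ embeds

    lz-run : Run (length S) (lzLength S) 0 (length (lzFactorization S))
    lz-run = factorize-run S (IsLZ.nonempty lzLength-isLZ)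

    lex-run : Run (length S) (λ b → maxSmallerLCP S b ⊔ 1) 0 (length (lexParse S))
    lex-run = factorize-run S (λ {i} _ → m≤n⊔m (maxSmallerLCP S i) 1)

module _ (Σ : Alphabet) where
  private module P = Parsing Σ
  private module N = Parsing ℕ<

  module _ {S r} (embeds : Embeds Σ S r) where
    private
      open Encoding Σ embeds
      R = map r S
      module E = Encoding ℕ< (Embeds-id R)

      isLZ : IsLZ s (length S) (N.lzLength R)
      isLZ = subst₂ (λ T n → IsLZ (code T) n (N.lzLength R)) (map-id R) (length-map r S) E.lzLength-isLZ

      isPLCP : IsPLCP s (length S) (N.maxSmallerLCP R)
      isPLCP = subst₂ (λ T n → IsPLCP (code T) n (N.maxSmallerLCP R)) (map-id R) (length-map r S)
                 E.maxSmallerLCP-isPLCP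

    -- Both length functions satisfy `IsLZ` for the same code `s`, hence coincide at every position
    -- of the string.
    lzFactorization-map : length (P.lzFactorization S) ≡ length (N.lzFactorization R)
    lzFactorization-map = Run-unique (IsLZ-unique lzLength-isLZ isLZ) (lz-run Σ embeds)
      (subst (λ n → Run n (N.lzLength R) 0 (length (N.lzFactorization R))) (length-map r S)
        (lz-run ℕ< (Embeds-id R)))

    lexParse-map : length (P.lexParse S) ≡ length (N.lexParse R)
    lexParse-map = Run-unique (λ i<n → cong (_⊔ 1) (IsPLCP-unique maxSmallerLCP-isPLCP isPLCP i<n))
      (lex-run Σ embeds)
      (subst (λ n → Run n (λ b → N.maxSmallerLCP R b ⊔ 1) 0 (length (N.lexParse R))) (length-map r S)
        (lex-run ℕ< (Embeds-id R)))

-- Reduction of an arbitrary alphabet to ranks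

module _ {A : Set} {P Q : Pred A 0ℓ} (P? : Decidable P) (Q? : Decidable Q) where

  count-mono-≤ : (∀ {x} → P x → Q x) → ∀ xs → length (filter P? xs) ≤ length (filter Q? xs)
  count-mono-≤ P⊆Q [] = z≤n
  count-mono-≤ P⊆Q (x ∷ xs) with P? x | Q? x
  ... | yes _ | yes _ = s≤s (count-mono-≤ P⊆Q xs)
  ... | yes p | no ¬q = contradiction (P⊆Q p) ¬q
  ... | no _  | yes _ = m≤n⇒m≤1+n (count-mono-≤ P⊆Q xs)
  ... | no _  | no _  = count-mono-≤ P⊆Q xs

  count-mono-< : (∀ {x} → P x → Q x) → ∀ {x xs} → x ∈ xs → ¬ P x → Q x →
                 length (filter P? xs) < length (filter Q? xs)
  count-mono-< P⊆Q {x} {x ∷ xs} (here refl) ¬p q with P? x | Q? x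
  ... | yes p | _     = contradiction p ¬p
  ... | no _  | yes _ = s≤s (count-mono-≤ P⊆Q xs)
  ... | no _  | no ¬q = contradiction q ¬q
  count-mono-< P⊆Q {xs = y ∷ xs} (there x∈) ¬p q with P? y | Q? y
  ... | yes _ | yes _ = s≤s (count-mono-< P⊆Q x∈ ¬p q)
  ... | yes p | no ¬q = contradiction (P⊆Q p) ¬q
  ... | no _  | yes _ = m≤n⇒m≤1+n (count-mono-< P⊆Q x∈ ¬p q)
  ... | no _  | no _  = count-mono-< P⊆Q x∈ ¬p q

module _ (Σ : Alphabet) where
  private module Σ = StrictTotalOrder Σ

  -- Smaller letters are counted with multiplicity. The value is still at most `length S`, which is
  -- all that a finite alphabet requires.
  rank : List (Carrier Σ) → Carrier Σ → ℕ
  rank S x = length (filter (Σ._<? x) S)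

  rank-embeds : ∀ S → Embeds Σ S (rank S)
  rank-embeds S = record
    { resp = λ {x} {y} _ _ x≈y → ≤-antisym
        (count-mono-≤ (Σ._<? x) (Σ._<? y) (Σ.<-respʳ-≈ x≈y) S)
        (count-mono-≤ (Σ._<? y) (Σ._<? x) (Σ.<-respʳ-≈ (Σ.Eq.sym x≈y)) S)
    ; mono = λ {x} {y} x∈ _ x<y →
        count-mono-< (Σ._<? x) (Σ._<? y) (λ z<x → Σ.trans z<x x<y) x∈ (Σ.irrefl Σ.Eq.refl) x<y
    }

  v/z-rank : ∀ {n} .{{_ : NonZero n}} (S : Vec (Carrier Σ) n) →
             v/z Σ S ≡ v/z ℕ< (Vec.map (rank (toList S)) S)
  v/z-rank S = fraction {{Parsing.z-nonZero Σ S}} {{Parsing.z-nonZero ℕ< (Vec.map (rank (toList S)) S)}}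
                        (trans (lexParse-map Σ embeds) (cong (length ∘ Parsing.lexParse ℕ<) eq))
                        (trans (lzFactorization-map Σ embeds) (cong (length ∘ Parsing.lzFactorization ℕ<) eq))
    where
    embeds = rank-embeds (toList S)
    eq : map (rank (toList S)) (toList S) ≡ toList (Vec.map (rank (toList S)) S)
    eq = sym (toList-map _ S)
    fraction : ∀ {a a′ b b′} .{{_ : NonZero b}} .{{_ : NonZero b′}} → a ≡ a′ → b ≡ b′ →
               (ℤ.+ a ℚ./ b) ≡ (ℤ.+ a′ ℚ./ b′)
    fraction refl refl = refl

vectors : ∀ {A : Set} → List A → ∀ n → List (Vec A n)
vectors xs zero    = [ [] ]
vectors xs (suc n) = cartesianProductWith _∷_ xs (vectors xs n)

∈-vectors : ∀ {A : Set} {xs : List A} {n} (w : Vec A n) → All (_∈ xs) (toList w) → w ∈ vectors xs n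
∈-vectors []      []         = here refl
∈-vectors (x ∷ w) (x∈ ∷ w∈) = ∈-cartesianProductWith⁺ _∷_ x∈ (∈-vectors w w∈)

private module ℚ-Extrema = Data.List.Extrema (DecTotalOrder.totalOrder ℚ.≤-decTotalOrder)

-- Ranks in a string of length `n` are at most `n`, so by `v/z-rank` the letters `0, ..., n` already
-- realize every ratio.
bestString : ∀ n .{{_ : NonZero n}} → Vec ℕ n
bestString n = ℚ-Extrema.argmax (v/z ℕ<) (Vec.replicate n 0) (vectors (upTo (suc n)) n)

Ratio : ℕ → ℚ
Ratio zero      = 0ℚ
Ratio n@(suc _) = v/z ℕ< (bestString n)

Ratio-isMax : ∀ n .{{_ : NonZero n}} → IsMaxRatio n (Ratio n)
Ratio-isMax n@(suc _) = (ℕ< , bestString n , refl) , upper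
  where
  upper : ∀ Σ (S : Vec (Carrier Σ) n) → v/z Σ S ℚ.≤ Ratio n
  upper Σ S = subst (ℚ._≤ Ratio n) (sym (v/z-rank Σ S))
    (All.lookup (ℚ-Extrema.f[xs]≤f[argmax] {f = v/z ℕ<} (Vec.replicate n 0) (vectors (upTo (suc n)) n))
      (∈-vectors _ (small S)))
    where
    rank< : ∀ x → rank Σ (toList S) x < suc n
    rank< x = s≤s (subst (rank Σ (toList S) x ≤_) (length-toList S) (length-filter _ (toList S)))
    small : ∀ {m} (T : Vec (Carrier Σ) m) → All (_∈ upTo (suc n)) (toList (Vec.map (rank Σ (toList S)) T))
    small []      = []
    small (x ∷ T) = ∈-upTo⁺ (rank< x) ∷ small T

-- Lower bound

-- A l and B l are the Fibonacci numbers with indices 2l − 1 and 2l.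
mutual
  A : ℕ → ℕ
  A zero    = 1
  A (suc l) = A l + B l

  B : ℕ → ℕ
  B zero    = 0
  B (suc l) = A (suc l) + B l

A>0 : ∀ l → 0 < A l
A>0 zero    = s≤s z≤n
A>0 (suc l) = ≤-trans (A>0 l) (m≤m+n _ _)

B<B : ∀ l → B l < B (suc l)
B<B l = m<n+m (B l) (A>0 (suc l))

B-mono : ∀ l d → B l ≤ B (d + l)
B-mono l zero    = ≤-refl
B-mono l (suc d) = ≤-trans (B-mono l d) (<⇒≤ (B<B (d + l)))

B≤A : ∀ l → B l ≤ A (suc l)
B≤A l = m≤n+m (B l) (A l)

B>0 : ∀ l → 0 < B (suc l)
B>0 l = ≤-trans (A>0 (suc l)) (m≤m+n _ _)

A≤B : ∀ l → A (suc l) ≤ B (suc l)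
A≤B l = m≤m+n _ _

-- The values of o at the Fibonacci numbers alternately approach 0 and N, where
-- they are again Fibonacci numbers or their distances from N; between
-- consecutive Fibonacci numbers no value is more extreme.
module Rotation (k₀ : ℕ) where

  -- From `k = 2` on, `N` exceeds 1; the case `zero` of `A<N` below relies on this.
  k N x : ℕ
  k = suc (suc k₀)
  N = B k
  x = A k

  N>0 : 0 < N
  N>0 = B>0 (suc k₀)

  instance
    N≢0 : NonZero N
    N≢0 = >-nonZero N>0

  o : ℕ → ℕ
  o i = (i * x) % N

  o<N : ∀ i → o i < N
  o<N i = m%n<n (i * x) N

  -- Multiples of `N` on both sides express congruences of either sign without subtraction.
  residue-unique : ∀ {a r} u w → r < N → a + u * N ≡ r + w * N → a % N ≡ r
  residue-unique {a} {r} u w r<N eq = begin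
    a % N            ≡⟨ [m+kn]%n≡m%n a u N ⟨
    (a + u * N) % N  ≡⟨ cong (_% N) eq ⟩
    (r + w * N) % N  ≡⟨ [m+kn]%n≡m%n r w N ⟩
    r % N            ≡⟨ m<n⇒m%n≡m r<N ⟩
    r                ∎
    where open ≡-Reasoning

  quotient : ∀ i → ∃[ c ] i * x ≡ o i + c * N
  quotient i = (i * x) / N , m≡m%n+[m/n]*n (i * x) N

  -- Two cases of d'Ocagne's identity: modulo `N`, `B j * x` is `- B l` and `A (suc j) * x` is
  -- `A l`. The quotients are again Fibonacci numbers, which makes the induction a matter of the
  -- recurrences.
  convergents : ∀ j {l} → j + l ≡ k →
                (B j * x + B l ≡ A j * N) × (A (suc j) * x ≡ A l + B j * N)
  convergents zero    refl = sym (+-identityʳ N) , refl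
  convergents (suc j) {l} eq with I₁ , I₂ ← convergents j (trans (+-suc j l) eq) =
    J₁ , +-cancelˡ-≡ (B l) _ _ J₂
    where
    open ≡-Reasoning
    regroup₁ : ∀ a b x c → (a + b) * x + c ≡ a * x + b * x + c
    regroup₁ = solve-∀
    regroup₂ : ∀ a a′ b b′ N x → a′ + b * N + b * x + b′ ≡ b * N + (b * x + (a′ + b′))
    regroup₂ = solve-∀
    J₁ : B (suc j) * x + B l ≡ A (suc j) * N
    J₁ = begin
      (A (suc j) + B j) * x + B l           ≡⟨ regroup₁ (A (suc j)) (B j) x (B l) ⟩
      A (suc j) * x + B j * x + B l         ≡⟨ cong (λ y → y + B j * x + B l) I₂ ⟩
      A (suc l) + B j * N + B j * x + B l   ≡⟨ regroup₂ (A j) (A (suc l)) (B j) (B l) N x ⟩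
      B j * N + (B j * x + B (suc l))       ≡⟨ cong (B j * N +_) I₁ ⟩
      B j * N + A j * N                     ≡⟨ trans (+-comm (B j * N) (A j * N)) (sym (*-distribʳ-+ N (A j) (B j))) ⟩
      (A j + B j) * N                       ∎
    regroup₃ : ∀ a b x c → c + (a + b) * x ≡ a * x + (b * x + c)
    regroup₃ = solve-∀
    regroup₄ : ∀ a b c d N → a + b + c * N + d * N ≡ b + (a + (d + c) * N)
    regroup₄ = solve-∀
    J₂ : B l + A (suc (suc j)) * x ≡ B l + (A l + B (suc j) * N)
    J₂ = begin
      B l + (A (suc j) + B (suc j)) * x         ≡⟨ regroup₃ (A (suc j)) (B (suc j)) x (B l) ⟩
      A (suc j) * x + (B (suc j) * x + B l)     ≡⟨ cong₂ _+_ I₂ J₁ ⟩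
      A l + B l + B j * N + A (suc j) * N       ≡⟨ regroup₄ (A l) (B l) (B j) (A (suc j)) N ⟩
      B l + (A l + B (suc j) * N)               ∎

  private
    B≤N : ∀ {j l} → j + l ≡ k → B l ≤ N
    B≤N {j} {l} eq = subst (λ m → B l ≤ B m) eq (B-mono l j)

    A≤N : ∀ {j l} → j + suc l ≡ k → 0 < B j → A (suc (suc l)) ≤ N
    A≤N {suc j} {l} eq _ = ≤-trans (A≤B (suc l)) (B≤N {j} (trans (+-suc j (suc l)) eq))

    Bounds : ℕ → ℕ → ℕ → Set
    Bounds lo hi m = lo ≤ o m × o m + hi ≤ N

  -- Each range of `m` is an earlier one extended by a translate. Adding `A (suc j)` to `m` raises
  -- `o` by `A (suc l)`, adding `B (suc j)` lowers it by `B l`, and the bounds already known leave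
  -- room for this without wraparound. The hypothesis `0 < l` keeps `m = N`, where `o` is 0, out of
  -- the second range.
  bounds : ∀ j {l} → j + l ≡ k →
           (∀ m → 0 < m → m < B j → Bounds (A (suc l)) (B (suc l)) m) ×
           (0 < l → ∀ m → 0 < m → m < A (suc j) → Bounds (A (suc l)) (B l) m)
  bounds zero    _ = (λ _ _ ()) , λ { _ (suc _) _ (s≤s ()) }
  bounds (suc j) {l} eq with P , R ← bounds j (trans (+-suc j l) eq) = P′ , R′
    where
    eq₁ : j + suc l ≡ k
    eq₁ = trans (+-suc j l) eq
    a = A (suc j)
    b = B (suc j)

    A<B+A+B : A (suc l) < B (suc (suc l))
    A<B+A+B = ≤-<-trans (m≤m+n (A (suc l)) (B (suc l)))
      (m<m+n (A (suc l) + B (suc l)) (B>0 l))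

    beyond-a : ∀ m → m < B j → Bounds (A (suc l)) (B (suc l)) (a + m)
    beyond-a zero 0<B = subst (Bounds (A (suc l)) (B (suc l))) (sym (+-identityʳ a))
      (≤-reflexive (sym o≡) , subst (λ y → y + B (suc l) ≤ N) (sym o≡) A₂≤N)
      where
      A₂≤N : A (suc (suc l)) ≤ N
      A₂≤N = A≤N eq₁ 0<B
      o≡ : o a ≡ A (suc l)
      o≡ = residue-unique 0 (B j)
        (<-≤-trans (m<m+n (A (suc l)) (B>0 l)) A₂≤N)
        (trans (+-identityʳ _) (proj₂ (convergents j eq₁)))
    beyond-a (suc m′) m<B with lo , hi ← P (suc m′) (s≤s z≤n) m<B
                          with c , qm ← quotient (suc m′) =
      subst (A (suc l) ≤_) (sym o≡) (m≤n+m (A (suc l)) (o m)) , subst (λ y → y + B (suc l) ≤ N) (sym o≡) hi′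
      where
      m = suc m′
      hi′ : o m + A (suc l) + B (suc l) ≤ N
      hi′ = ≤-trans (subst (_≤ o m + B (suc (suc l))) (sym (+-assoc (o m) _ _)) (+-monoʳ-≤ (o m) (A≤B (suc l)))) hi
      regroup : ∀ a m x l b N o c → a * x ≡ l + b * N → m * x ≡ o + c * N → (a + m) * x + 0 ≡ o + l + (b + c) * N
      regroup a m x l b N o c e₁ e₂ = begin
        (a + m) * x + 0              ≡⟨ +-identityʳ _ ⟩
        (a + m) * x                  ≡⟨ *-distribʳ-+ x a m ⟩
        a * x + m * x                ≡⟨ cong₂ _+_ e₁ e₂ ⟩
        l + b * N + (o + c * N)      ≡⟨ lemma l b N o c ⟩
        o + l + (b + c) * N          ∎
        where
        open ≡-Reasoning
        lemma : ∀ l b N o c → l + b * N + (o + c * N) ≡ o + l + (b + c) * N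
        lemma = solve-∀
      o≡ : o (a + m) ≡ o m + A (suc l)
      o≡ = residue-unique 0 (B j + c) (<-≤-trans (+-monoʳ-< (o m) A<B+A+B) hi)
        (regroup a m x (A (suc l)) (B j) N (o m) c (proj₂ (convergents j eq₁)) qm)

    P′ : ∀ m → 0 < m → m < B (suc j) → Bounds (A (suc l)) (B (suc l)) m
    P′ m 0<m m<b with m <? a
    ... | yes m<a with lo , hi ← R (s≤s z≤n) m 0<m m<a = ≤-trans (m≤m+n _ _) lo , hi
    ... | no  m≮a = subst (Bounds (A (suc l)) (B (suc l))) (m+[n∸m]≡n (≮⇒≥ m≮a))
      (beyond-a (m ∸ a) (subst (m ∸ a <_) (m+n∸m≡n a (B j)) (∸-monoˡ-< m<b (≮⇒≥ m≮a))))

    A+B≤N : A (suc l) + B l ≤ N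
    A+B≤N = B≤N {j} eq₁

    o-beyond-b : ∀ m r c → r + B l ≤ N → 0 < B l → m * x ≡ r + B l + c * N → o (b + m) ≡ r
    o-beyond-b m r c r≤ 0<B qm = residue-unique 0 (a + c) (<-≤-trans (m<m+n r 0<B) r≤)
      (+-cancelʳ-≡ (B l) _ _ (begin
        (b + m) * x + 0 + B l        ≡⟨ lemma₁ b m x (B l) ⟩
        b * x + B l + m * x          ≡⟨ cong₂ _+_ (proj₁ (convergents (suc j) eq)) qm ⟩
        a * N + (r + B l + c * N)    ≡⟨ lemma₂ a N r (B l) c ⟩
        r + (a + c) * N + B l        ∎))
      where
      open ≡-Reasoning
      lemma₁ : ∀ b m x l → (b + m) * x + 0 + l ≡ b * x + l + m * x
      lemma₁ = solve-∀
      lemma₂ : ∀ a N r l c → a * N + (r + l + c * N) ≡ r + (a + c) * N + l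
      lemma₂ = solve-∀

    beyond-b : 0 < B l → ∀ m → m < a → Bounds (A (suc l)) (B l) (b + m)
    beyond-b 0<B zero _ = subst (A (suc l) ≤_) (sym o≡) lo , subst (λ y → y + B l ≤ N) (sym o≡) (≤-reflexive r+B)
      where
      r = N ∸ B l
      r+B : r + B l ≡ N
      r+B = m∸n+n≡m (≤-trans (m≤n+m (B l) (A (suc l))) A+B≤N)
      lo : A (suc l) ≤ r
      lo = m+n≤o⇒m≤o∸n (A (suc l)) A+B≤N
      o≡ : o (b + 0) ≡ r
      o≡ = residue-unique 1 a (<-≤-trans (m<m+n r 0<B) (≤-reflexive r+B))
        (+-cancelʳ-≡ (B l) _ _ (begin
          (b + 0) * x + 1 * N + B l  ≡⟨ lemma₁ b x N (B l) ⟩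
          b * x + B l + N            ≡⟨ cong (_+ N) (proj₁ (convergents (suc j) eq)) ⟩
          a * N + N                  ≡⟨ cong (a * N +_) (sym r+B) ⟩
          a * N + (r + B l)          ≡⟨ lemma₂ (a * N) r (B l) ⟩
          r + a * N + B l            ∎))
        where
        open ≡-Reasoning
        lemma₁ : ∀ b x N l → (b + 0) * x + 1 * N + l ≡ b * x + l + N
        lemma₁ = solve-∀
        lemma₂ : ∀ y r l → y + (r + l) ≡ r + y + l
        lemma₂ = solve-∀
    beyond-b 0<B (suc m′) m<a with lo , hi ← R (s≤s z≤n) (suc m′) (s≤s z≤n) m<a
                              with c , qm ← quotient (suc m′) =
      subst (A (suc l) ≤_) (sym o≡) lo′ , subst (λ y → y + B l ≤ N) (sym o≡) hi′
      where
      m = suc m′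
      A+B≤o : A (suc l) + B l ≤ o m
      A+B≤o = ≤-trans (+-monoʳ-≤ (A (suc l)) (<⇒≤ (B<B l))) lo
      r = o m ∸ B l
      r+B : r + B l ≡ o m
      r+B = m∸n+n≡m (≤-trans (m≤n+m (B l) (A (suc l))) A+B≤o)
      lo′ : A (suc l) ≤ r
      lo′ = m+n≤o⇒m≤o∸n (A (suc l)) A+B≤o
      hi′ : r + B l ≤ N
      hi′ = subst (_≤ N) (sym r+B) (<⇒≤ (o<N m))
      o≡ : o (b + m) ≡ r
      o≡ = o-beyond-b m r c hi′ 0<B (trans qm (cong (_+ c * N) (sym r+B)))

    R′ : 0 < l → ∀ m → 0 < m → m < A (suc (suc j)) → Bounds (A (suc l)) (B l) m
    R′ 0<l m 0<m m<a+b with m <? b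
    ... | yes m<b with lo , hi ← P′ m 0<m m<b = lo , ≤-trans (+-monoʳ-≤ (o m) (<⇒≤ (B<B l))) hi
    ... | no  m≮b = subst (Bounds (A (suc l)) (B l)) (m+[n∸m]≡n (≮⇒≥ m≮b))
      (beyond-b (0<B-pred 0<l) (m ∸ b) (subst (m ∸ b <_) (m+n∸n≡m a b) (∸-monoˡ-< m<a+b (≮⇒≥ m≮b))))
      where
      0<B-pred : ∀ {l} → 0 < l → 0 < B l
      0<B-pred {suc l} _ = B>0 l

  o>0 : ∀ m → 0 < m → m < N → 0 < o m
  o>0 m 0<m m<N = proj₁ (proj₁ (bounds k (+-identityʳ k)) m 0<m m<N)

  -- Turns `bounds`, which concerns positions counted from 0, into a statement on distances from the
  -- end of the row.
  reflect : ∀ {i m} → i + m ≡ N → 0 < o m → o i + o m ≡ N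
  reflect {i} {m} i+m 0<o with c , qm ← quotient m =
    trans (cong (_+ o m) o≡) r+o
    where
    r = N ∸ o m
    r+o : r + o m ≡ N
    r+o = m∸n+n≡m (<⇒≤ (o<N m))
    open ≡-Reasoning
    lemma : ∀ i x c N o r m → m * x ≡ o + c * N → i * x + (c * N + (r + o)) ≡ r + (i * x + m * x)
    lemma i x c N o r m e = trans (shuffle (i * x) (c * N) o r) (cong (λ y → r + (i * x + y)) (sym e))
      where
      shuffle : ∀ i c o r → i + (c + (r + o)) ≡ r + (i + (o + c))
      shuffle = solve-∀
    o≡ : o i ≡ r
    o≡ = residue-unique (suc c) x (<-≤-trans (m<m+n r 0<o) (≤-reflexive r+o)) (begin
      i * x + (N + c * N)           ≡⟨ cong (i * x +_) (+-comm N (c * N)) ⟩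
      i * x + (c * N + N)           ≡⟨ cong (λ y → i * x + (c * N + y)) r+o ⟨
      i * x + (c * N + (r + o m))   ≡⟨ lemma i x c N (o m) r m qm ⟩
      r + (i * x + m * x)           ≡⟨ cong (r +_) (*-distribʳ-+ x i m) ⟨
      r + (i + m) * x               ≡⟨ cong (λ y → r + y * x) i+m ⟩
      r + N * x                     ≡⟨ cong (r +_) (*-comm N x) ⟩
      r + x * N                     ∎)

  record Spiral (j i : ℕ) : Set where
    field
      turn    : i + B j < N
      lowest  : ∀ t → 0 < t → i + t < N → o i < o (i + t)
      highest : ∀ t → i + t < N → o (i + t) ≤ o (i + B j)

  -- After reflection, `bounds` confines the letters after `i` to `[B (suc l), N - A (suc l)]`. The
  -- value at `i` is `B l`, just below this interval, and its upper end is attained at `i + B j`, at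
  -- distance `A (suc j)` from the end of the row.
  spiral : ∀ {j l i} → suc j + l ≡ k → i + B (suc j) ≡ N → Spiral j i
  spiral {j} {l} {i} eq i+B = record { turn = turn ; lowest = lowest ; highest = highest }
    where
    eq₁ : j + suc l ≡ k
    eq₁ = trans (+-suc j l) eq
    i+B+A : i + B j + A (suc j) ≡ N
    i+B+A = trans (trans (+-assoc i (B j) (A (suc j))) (cong (i +_) (+-comm (B j) (A (suc j))))) i+B
    turn : i + B j < N
    turn = subst (i + B j <_) i+B+A (m<m+n (i + B j) (A>0 (suc j)))
    Bl<N : B l < N
    Bl<N = <-≤-trans (B<B l) (B≤N {j} eq₁)
    o-bottom : o i ≡ B l
    o-bottom = residue-unique (A (suc j)) x Bl<N (begin
      i * x + A (suc j) * N            ≡⟨ cong (i * x +_) (proj₁ (convergents (suc j) eq)) ⟨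
      i * x + (B (suc j) * x + B l)    ≡⟨ lemma i x (B (suc j)) (B l) ⟩
      B l + (i + B (suc j)) * x        ≡⟨ cong (λ y → B l + y * x) i+B ⟩
      B l + N * x                      ≡⟨ cong (B l +_) (*-comm N x) ⟩
      B l + x * N                      ∎)
      where
      open ≡-Reasoning
      lemma : ∀ i x b l → i * x + (b * x + l) ≡ l + (i + b) * x
      lemma = solve-∀
    above : ∀ t → 0 < t → i + t < N → B (suc l) ≤ o (i + t) × o (i + t) + A (suc l) ≤ N
    above t 0<t i+t<N =
      +-cancelʳ-≤ (o m) _ _ (subst (B (suc l) + o m ≤_) (sym sum) (subst (_≤ N) (+-comm (o m) _) (proj₂ bs)))
      , subst (o (i + t) + A (suc l) ≤_) sum (+-monoʳ-≤ (o (i + t)) (proj₁ bs))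
      where
      m = N ∸ (i + t)
      m>0 : 0 < m
      m>0 = m<n⇒0<n∸m i+t<N
      m<B : m < B (suc j)
      m<B = subst (m <_) (trans (cong (_∸ i) (sym i+B)) (m+n∸m≡n i _))
              (∸-monoʳ-< (m<m+n i 0<t) (<⇒≤ i+t<N))
      bs : Bounds (A (suc l)) (B (suc l)) m
      bs = proj₁ (bounds (suc j) eq) m m>0 m<B
      sum : o (i + t) + o m ≡ N
      sum = reflect {i + t} {m} (m+[n∸m]≡n (<⇒≤ i+t<N)) (≤-trans (A>0 (suc l)) (proj₁ bs))
    lowest : ∀ t → 0 < t → i + t < N → o i < o (i + t)
    lowest t 0<t i+t<N = subst (_< o (i + t)) (sym o-bottom) (<-≤-trans (B<B l) (proj₁ (above t 0<t i+t<N)))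
    A<N : ∀ l → B (suc l) ≤ N → A (suc l) < N
    A<N zero    _   = ≤-<-trans (B>0 k₀) (B<B (suc k₀))
    A<N (suc l) B≤N = <-≤-trans (m<m+n (A (suc (suc l))) (B>0 l)) B≤N
    o-A : o (A (suc j)) ≡ A (suc l)
    o-A = residue-unique 0 (B j) (A<N l (B≤N {j} eq₁)) (trans (+-identityʳ _) (proj₂ (convergents j eq₁)))
    o-top : o (i + B j) + A (suc l) ≡ N
    o-top = subst (λ y → o (i + B j) + y ≡ N) o-A
      (reflect {i + B j} {A (suc j)} i+B+A (subst (0 <_) (sym o-A) (A>0 (suc l))))
    highest : ∀ t → i + t < N → o (i + t) ≤ o (i + B j)
    highest zero    _     with m≤n⇒m<n∨m≡n (z≤n {B j})
    ... | inj₁ 0<B = subst (λ y → o y ≤ o (i + B j)) (sym (+-identityʳ i)) (<⇒≤ (lowest (B j) 0<B turn))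
    ... | inj₂ 0≡B = ≤-reflexive (cong (λ y → o (i + y)) 0≡B)
    highest (suc t) i+t<N = +-cancelʳ-≤ (A (suc l)) _ _
      (subst (o (i + suc t) + A (suc l) ≤_) (sym o-top) (proj₂ (above (suc t) (s≤s z≤n) i+t<N)))

-- Certificates for phrase counts

data Cover (s : ℕ → ℕ) (n : ℕ) : ℕ → ℕ → Set where
  done    : ∀ {a} → n ≤ a → Cover s n a 0
  literal : ∀ {a m} → Cover s n (suc a) m → Cover s n a (suc m)
  copy    : ∀ {a m p} ℓ → p < a → a + ℓ ≤ n → Agree s p a ℓ → Cover s n (a + ℓ) m → Cover s n a (suc m)

module _ {s n lz} (isLZ : IsLZ s n lz) where
  open IsLZ isLZ

  -- The greedy parsing never falls behind: if a copy reaches beyond the start `b` of an LZ phrase,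
  -- its part from `b` on also has an earlier occurrence, so that phrase reaches the end of the copy
  -- too.
  lz-optimal : ∀ {a b m z} → Cover s n a m → Run n lz b z → a ≤ b → z ≤ m
  lz-optimal _ (stop _) _ = z≤n
  lz-optimal (done n≤a) (step b<n _) a≤b = contradiction (≤-trans n≤a a≤b) (<⇒≱ b<n)
  lz-optimal {a} {b} (literal c) r@(step b<n r′) a≤b with m≤n⇒m<n∨m≡n a≤b
  ... | inj₁ a<b  = m≤n⇒m≤1+n (lz-optimal c r a<b)
  ... | inj₂ refl = s≤s (lz-optimal c r′ (m<m+n a (nonempty b<n)))
  lz-optimal {a} {b} (copy {p = p} ℓ p<a a+ℓ≤n ag c) r@(step b<n r′) a≤b with a + ℓ ≤? b
  ... | yes a+ℓ≤b = m≤n⇒m≤1+n (lz-optimal c r a+ℓ≤b)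
  ... | no  a+ℓ≰b = s≤s (lz-optimal c r′ (subst (_≤ b + lz b) b+rest (+-monoʳ-≤ b rest≤lz)))
    where
    d    = b ∸ a
    rest = a + ℓ ∸ b
    a+d  : a + d ≡ b
    a+d  = m+[n∸m]≡n a≤b
    b+rest : b + rest ≡ a + ℓ
    b+rest = m+[n∸m]≡n (≰⇒≥ a+ℓ≰b)
    d+rest : d + rest ≡ ℓ
    d+rest = +-cancelˡ-≡ a (d + rest) ℓ
      (trans (sym (+-assoc a d rest)) (trans (cong (_+ rest) a+d) b+rest))
    rest≤lz : rest ≤ lz b
    rest≤lz = longest (subst (p + d <_) a+d (+-monoˡ-< d p<a))
      (subst (_≤ n) (sym b+rest) a+ℓ≤n)
      (subst (λ y → Agree s (p + d) y rest) a+d (Agree-+ d (≤-reflexive d+rest) ag))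

-- A certificate for many lex-parse phrases. The condition in `link` bounds the PLCP value at `a` by
-- `d`, so by `phrase-end` no phrase starting at or before `a` gets past `a + d`: each link costs
-- the parsing a phrase of its own.
data Chain (s : ℕ → ℕ) (n : ℕ) : ℕ → ℕ → Set where
  end  : ∀ {a} → Chain s n a 0
  skip : ∀ {a a′ m} → a ≤ a′ → Chain s n a′ m → Chain s n a m
  link : ∀ {a m} d → a < n → (∀ {p} → p < n → Less s p a → Agree s p a (suc d) → ⊥) →
         0 < d → Chain s n (a + d) m → Chain s n a (suc m)

module _ {s n plcp} (isPLCP : IsPLCP s n plcp) where
  open IsPLCP isPLCP

  private
    -- PLCP values decrease by at most 1 from one position to the next, so a
    -- small value at a bounds every phrase that starts before a.
    phrase-end : ∀ {a b d} → a < n → (∀ {p} → p < n → Less s p a → Agree s p a (suc d) → ⊥) →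
                 b ≤ a → b + plcp b ≤ a + d
    phrase-end {a} {b} {d} a<n short b≤a = ≮⇒≥ λ a+d< →
      let e       = a ∸ b
          b+e     = m+[n∸m]≡n b≤a
          e+1+d≤  = +-cancelˡ-≤ b (e + suc d) (plcp b) (≤-trans (≤-reflexive
                      (trans (sym (+-assoc b e (suc d))) (trans (cong (_+ suc d) b+e) (+-suc a d)))) a+d<)
          e<plcp  = <-≤-trans (m<m+n e (s≤s z≤n)) e+1+d≤
          p , p+plcp≤n , l , ag = attained (≤-<-trans b≤a a<n) (≤-<-trans z≤n e<plcp)
      in short (<-≤-trans (+-monoʳ-< p e<plcp) p+plcp≤n)
           (subst (Less s (p + e)) b+e (Less-+ e (Agree-≤ (<⇒≤ e<plcp) ag) l))
           (subst (λ y → Agree s (p + e) y (suc d)) b+e (Agree-+ e e+1+d≤ ag))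

  chain≤lex : ∀ {a b m v} → Chain s n a m → Run n (λ b → plcp b ⊔ 1) b v → b ≤ a → m ≤ v
  chain≤lex end _ _ = z≤n
  chain≤lex (skip a≤a′ c) r b≤a = chain≤lex c r (≤-trans b≤a a≤a′)
  chain≤lex (link d a<n _ _ _) (stop n≤b) b≤a = contradiction (≤-trans n≤b b≤a) (<⇒≱ a<n)
  chain≤lex {a} {b} (link d a<n short 0<d c) (step _ r) b≤a = s≤s (chain≤lex c r (begin
    b + (plcp b ⊔ 1)        ≡⟨ +-distribˡ-⊔ b (plcp b) 1 ⟩
    (b + plcp b) ⊔ (b + 1)  ≤⟨ ⊔-lub (phrase-end a<n short b≤a) (+-mono-≤ b≤a 0<d) ⟩
    a + d                   ∎))
    where open ≤-Reasoning

-- The text of translated rotations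

module Text (k₀ : ℕ) where
  open Rotation k₀

  W : ℕ
  W = suc N

  row<n : ∀ {n M e i} → M * W ≤ n → e < M → i < W → e * W + i < n
  row<n {e = e} fits e<M i<W = <-≤-trans (+-monoʳ-< (e * W) i<W)
    (≤-trans (≤-trans (≤-reflexive (+-comm (e * W) W)) (*-monoˡ-≤ W e<M)) fits)

  -- Row e is the permutation o of [0, N) translated by e, followed by a
  -- separator; M rows are followed by separators up to length n.  Codes are
  -- successors of letters, so separators have code 1.
  record IsText (s : ℕ → ℕ) (n M : ℕ) : Set where
    field
      fits      : M * W ≤ n
      letter    : ∀ {e i} → e < M → i < N → s (e * W + i) ≡ suc (suc (e + o i))
      separator : ∀ {e} → e < M → s (e * W + N) ≡ 1
      padding   : ∀ {p} → M * W ≤ p → p < n → s p ≡ 1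
      decode    : ∀ {p} → p < n → 1 < s p → ∃₂ λ e i → e < M × i < N × p ≡ e * W + i

  module _ {s n M} (text : IsText s n M) where
    open IsText text

    private
      read : ∀ {e i} t → e < M → i + t < N → s (e * W + i + t) ≡ suc (suc (e + o (i + t)))
      read {e} {i} t e<M lt = trans (cong s (+-assoc (e * W) i t)) (letter e<M lt)

      read-end : ∀ {e i} t → e < M → i + t ≡ N → s (e * W + i + t) ≡ 1
      read-end {e} {i} t e<M eq =
        trans (cong s (trans (+-assoc (e * W) i t) (cong (e * W +_) eq))) (separator e<M)

      -- Modulo `N`, both rows change by `t * x` over `t` positions, so a common letter propagates
      -- as a congruence. The quotients are carried along to avoid subtraction.
      translate : ∀ {e₁ e₂ o₁ o₂ p₁ p₂ i₁ i₂ a b c d t} →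
        i₁ * x ≡ o₁ + a * N → i₂ * x ≡ o₂ + b * N →
        (i₁ + t) * x ≡ p₁ + c * N → (i₂ + t) * x ≡ p₂ + d * N → e₂ + o₂ ≡ e₁ + o₁ →
        e₂ + p₂ + (d + a) * N ≡ e₁ + p₁ + (b + c) * N
      translate {e₁} {e₂} {o₁} {o₂} {p₁} {p₂} {i₁} {i₂} {a} {b} {c} {d} {t} h₁ h₂ g₁ g₂ eq = begin
        e₂ + p₂ + (d + a) * N            ≡⟨ shuffle₁ e₂ p₂ d a N ⟩
        e₂ + (p₂ + d * N) + a * N        ≡⟨ cong (λ y → e₂ + y + a * N) g₂ ⟨
        e₂ + (i₂ + t) * x + a * N        ≡⟨ shuffle₂ e₂ i₂ t x a N ⟩
        e₂ + i₂ * x + t * x + a * N      ≡⟨ cong (λ y → e₂ + y + t * x + a * N) h₂ ⟩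
        e₂ + (o₂ + b * N) + t * x + a * N ≡⟨ shuffle₃ e₂ o₂ b N t x a ⟩
        (e₂ + o₂) + (b * N + t * x + a * N) ≡⟨ cong (_+ (b * N + t * x + a * N)) eq ⟩
        (e₁ + o₁) + (b * N + t * x + a * N) ≡⟨ shuffle₄ e₁ o₁ b N t x a ⟩
        e₁ + (o₁ + a * N) + t * x + b * N ≡⟨ cong (λ y → e₁ + y + t * x + b * N) h₁ ⟨
        e₁ + i₁ * x + t * x + b * N      ≡⟨ shuffle₂ e₁ i₁ t x b N ⟨
        e₁ + (i₁ + t) * x + b * N        ≡⟨ cong (λ y → e₁ + y + b * N) g₁ ⟩
        e₁ + (p₁ + c * N) + b * N        ≡⟨ shuffle₅ e₁ p₁ c b N ⟩
        e₁ + p₁ + (b + c) * N            ∎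
        where
        open ≡-Reasoning
        shuffle₁ : ∀ e p d a N → e + p + (d + a) * N ≡ e + (p + d * N) + a * N
        shuffle₁ = solve-∀
        shuffle₂ : ∀ e i t x a N → e + (i + t) * x + a * N ≡ e + i * x + t * x + a * N
        shuffle₂ = solve-∀
        shuffle₃ : ∀ e o b N t x a → e + (o + b * N) + t * x + a * N ≡ (e + o) + (b * N + t * x + a * N)
        shuffle₃ = solve-∀
        shuffle₄ : ∀ e o b N t x a → (e + o) + (b * N + t * x + a * N) ≡ e + (o + a * N) + t * x + b * N
        shuffle₄ = solve-∀
        shuffle₅ : ∀ e p c b N → e + (p + c * N) + b * N ≡ e + p + (b + c) * N
        shuffle₅ = solve-∀

    -- If another suffix agrees with this one up to the next turn of the spiral,
    -- then it contains the extreme letters of the rest of the row.  All later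
    -- letters lie between those, so the two suffixes agree until this row ends,
    -- which happens first; hence the other suffix is not the smaller one.
    no-smaller : ∀ {e j i p} → e < M → Spiral j i → p < n →
                 Less s p (e * W + i) → Agree s p (e * W + i) (suc (B j)) → ⊥
    no-smaller {e} {j} {i} {p} e<M spi p<n l ag = Less-asym l (less T before′ there′)
      where
      open Spiral spi
      P = e * W + i
      i<N : i < N
      i<N = ≤-<-trans (m≤m+n i (B j)) turn
      sp : s p ≡ suc (suc (e + o i))
      sp = begin
        s p          ≡⟨ cong s (+-identityʳ p) ⟨
        s (p + 0)    ≡⟨ same ag 0 (s≤s z≤n) ⟩
        s (P + 0)    ≡⟨ cong s (+-identityʳ P) ⟩
        s P          ≡⟨ letter e<M i<N ⟩
        suc (suc (e + o i)) ∎
        where open ≡-Reasoning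
      place : ∃₂ λ e₂ i₂ → e₂ < M × i₂ < N × p ≡ e₂ * W + i₂
      place = decode p<n (subst (1 <_) (sym sp) (s≤s (s≤s z≤n)))
      e₂ = proj₁ place
      i₂ = proj₁ (proj₂ place)
      e₂<M : e₂ < M
      e₂<M = proj₁ (proj₂ (proj₂ place))
      i₂<N : i₂ < N
      i₂<N = proj₁ (proj₂ (proj₂ (proj₂ place)))
      p≡ : p ≡ e₂ * W + i₂
      p≡ = proj₂ (proj₂ (proj₂ (proj₂ place)))

      sp+ : ∀ t → s (p + t) ≡ s (e₂ * W + i₂ + t)
      sp+ t = cong (λ y → s (y + t)) p≡

      head-≡ : e₂ + o i₂ ≡ e + o i
      head-≡ = suc-injective (suc-injective (trans (sym (letter e₂<M i₂<N)) (trans (cong s (sym p≡)) sp)))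

      -- Otherwise a separator of the other row would face a letter of this one within the
      -- agreement.
      i₂+B<N : i₂ + B j < N
      i₂+B<N = ≰⇒> λ N≤ →
        let t    = N ∸ i₂
            i₂+t = m+[n∸m]≡n (<⇒≤ i₂<N)
            t≤B  = +-cancelˡ-≤ i₂ t (B j) (subst (_≤ i₂ + B j) (sym i₂+t) N≤)
            eq   = begin
              1                         ≡⟨ read-end t e₂<M i₂+t ⟨
              s (e₂ * W + i₂ + t)       ≡⟨ sp+ t ⟨
              s (p + t)                 ≡⟨ same ag t (s≤s t≤B) ⟩
              s (P + t)                 ≡⟨ read t e<M (≤-<-trans (+-monoʳ-≤ i t≤B) turn) ⟩
              suc (suc (e + o (i + t))) ∎
        in contradiction (suc-injective eq) 0≢1+n
        where open ≡-Reasoning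

      top-≡ : e₂ + o (i₂ + B j) ≡ e + o (i + B j)
      top-≡ = suc-injective (suc-injective (begin
        suc (suc (e₂ + o (i₂ + B j)))  ≡⟨ read (B j) e₂<M i₂+B<N ⟨
        s (e₂ * W + i₂ + B j)          ≡⟨ sp+ (B j) ⟨
        s (p + B j)                    ≡⟨ same ag (B j) ≤-refl ⟩
        s (P + B j)                    ≡⟨ read (B j) e<M turn ⟩
        suc (suc (e + o (i + B j)))    ∎))
        where open ≡-Reasoning

      -- The head and the top letter are shared, so the letter at `i + t` lies in the range
      -- `[e₂, e₂ + N)` of the other row. There a congruence modulo `N` is an equality.
      values-≡ : ∀ t → i + t < N → e₂ + o (i₂ + t) ≡ e + o (i + t)
      values-≡ t i+t<N = trans (cong (e₂ +_) o≡y) e₂+y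
        where
        y = e + o (i + t) ∸ e₂
        bottom : o i ≤ o (i + t)
        bottom with m≤n⇒m<n∨m≡n (z≤n {t})
        ... | inj₁ 0<t = <⇒≤ (lowest t 0<t i+t<N)
        ... | inj₂ refl = ≤-reflexive (cong o (sym (+-identityʳ i)))
        e₂+y : e₂ + y ≡ e + o (i + t)
        e₂+y = m+[n∸m]≡n (≤-trans (m≤m+n e₂ (o i₂)) (≤-trans (≤-reflexive head-≡) (+-monoʳ-≤ e bottom)))
        y<N : y < N
        y<N = +-cancelˡ-< e₂ y N (begin-strict
          e₂ + y               ≡⟨ e₂+y ⟩
          e + o (i + t)        ≤⟨ +-monoʳ-≤ e (highest t i+t<N) ⟩
          e + o (i + B j)      ≡⟨ top-≡ ⟨
          e₂ + o (i₂ + B j)    <⟨ +-monoʳ-< e₂ (o<N (i₂ + B j)) ⟩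
          e₂ + N               ∎)
          where open ≤-Reasoning
        q₁ = quotient i
        q₂ = quotient i₂
        q₃ = quotient (i + t)
        q₄ = quotient (i₂ + t)
        congruent : e₂ + (o (i₂ + t) + (proj₁ q₄ + proj₁ q₁) * N) ≡ e₂ + (y + (proj₁ q₂ + proj₁ q₃) * N)
        congruent = begin
          e₂ + (o (i₂ + t) + (proj₁ q₄ + proj₁ q₁) * N) ≡⟨ +-assoc e₂ _ _ ⟨
          e₂ + o (i₂ + t) + (proj₁ q₄ + proj₁ q₁) * N
            ≡⟨ translate {e} {e₂} {i₁ = i} {i₂} {a = proj₁ q₁} {proj₁ q₂} {proj₁ q₃} {proj₁ q₄} {t}
                 (proj₂ q₁) (proj₂ q₂) (proj₂ q₃) (proj₂ q₄) head-≡ ⟩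
          e + o (i + t) + (proj₁ q₂ + proj₁ q₃) * N     ≡⟨ cong (_+ (proj₁ q₂ + proj₁ q₃) * N) e₂+y ⟨
          e₂ + y + (proj₁ q₂ + proj₁ q₃) * N            ≡⟨ +-assoc e₂ y _ ⟩
          e₂ + (y + (proj₁ q₂ + proj₁ q₃) * N)          ∎
          where open ≡-Reasoning
        o≡y : o (i₂ + t) ≡ y
        o≡y = trans (sym (m<n⇒m%n≡m (o<N (i₂ + t))))
          (residue-unique (proj₁ q₄ + proj₁ q₁) (proj₁ q₂ + proj₁ q₃) y<N (+-cancelˡ-≡ e₂ _ _ congruent))

      -- `values-≡` also covers the virtual position `N` of the other row, where `o` is 0. Ending
      -- there would make `e₂` strictly larger than the head letter, although every letter of row
      -- `e₂` is at least `e₂`.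
      stays : ∀ t → i + t < N → i₂ + t < N
      stays t i+t<N = ≰⇒> λ N≤ →
        let t₀    = N ∸ i₂
            i₂+t₀ = m+[n∸m]≡n (<⇒≤ i₂<N)
            t₀≤t  = +-cancelˡ-≤ i₂ t₀ t (subst (_≤ i₂ + t) (sym i₂+t₀) N≤)
            i+t₀  = ≤-<-trans (+-monoʳ-≤ i t₀≤t) i+t<N
            o[N]  = trans (cong (_% N) (trans (cong (_* x) i₂+t₀) (*-comm N x))) (m*n%n≡0 x N)
        in <-irrefl refl (begin-strict
          e₂                   ≤⟨ m≤m+n e₂ (o i₂) ⟩
          e₂ + o i₂            ≡⟨ head-≡ ⟩
          e + o i              <⟨ +-monoʳ-< e (lowest t₀ (m<n⇒0<n∸m i₂<N) i+t₀) ⟩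
          e + o (i + t₀)       ≡⟨ values-≡ t₀ i+t₀ ⟨
          e₂ + o (i₂ + t₀)     ≡⟨ cong (e₂ +_) o[N] ⟩
          e₂ + 0               ≡⟨ +-identityʳ e₂ ⟩
          e₂                   ∎)
        where open ≤-Reasoning

      T = N ∸ i
      i+T : i + T ≡ N
      i+T = m+[n∸m]≡n (<⇒≤ i<N)

      i₂≢i : i₂ ≢ i
      i₂≢i i₂≡i = Less-irrefl (subst (λ y → Less s y P) p≡P l)
        where
        e₂≡e : e₂ ≡ e
        e₂≡e = +-cancelʳ-≡ (o i) e₂ e (trans (cong (λ y → e₂ + o y) (sym i₂≡i)) head-≡)
        p≡P : p ≡ P
        p≡P = trans p≡ (cong₂ (λ f g → f * W + g) e₂≡e i₂≡i)

      -- By `stays`, the other suffix is at least as far from the end of its row. Equal distances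
      -- would make the two suffixes the same.
      i₂+T<N : i₂ + T < N
      i₂+T<N = subst (i₂ + T <_) i+T (+-monoˡ-< T (≤∧≢⇒< i₂≤i i₂≢i))
        where
        T′ = pred T
        1+T′ : suc T′ ≡ T
        1+T′ = suc-pred T {{>-nonZero (m<n⇒0<n∸m i<N)}}
        i₂≤i : i₂ ≤ i
        i₂≤i = +-cancelʳ-≤ T i₂ i (subst₂ _≤_
          (trans (sym (+-suc i₂ T′)) (cong (i₂ +_) 1+T′)) (sym i+T)
          (stays T′ (subst (i + T′ <_) i+T (+-monoʳ-< i (≤-reflexive 1+T′)))))

      before′ : Agree s P p T
      before′ = agree λ t t<T →
        let i+t<N = subst (i + t <_) i+T (+-monoʳ-< i t<T)
        in begin
          s (P + t)                       ≡⟨ read t e<M i+t<N ⟩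
          suc (suc (e + o (i + t)))       ≡⟨ cong (λ y → suc (suc y)) (values-≡ t i+t<N) ⟨
          suc (suc (e₂ + o (i₂ + t)))     ≡⟨ read t e₂<M (stays t i+t<N) ⟨
          s (e₂ * W + i₂ + t)             ≡⟨ sp+ t ⟨
          s (p + t)                       ∎
        where open ≡-Reasoning

      there′ : s (P + T) < s (p + T)
      there′ = subst₂ _<_ (sym (read-end T e<M i+T)) (sym (trans (sp+ T) (read T e₂<M i₂+T<N))) (s≤s (s≤s z≤n))

    private
      -- The breaks lie at the distances `B j` from the end of the row, and the link from distance
      -- `B (suc j)` has length `A (suc j)`. Since `B j ≤ A (suc j)`, an agreement longer than the
      -- link includes the maximum, as `no-smaller` demands.
      row-chain : ∀ {e m} → e < M → ∀ j {l} → j + l ≡ k → Chain s n (e * W + N) m →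
                  Chain s n (e * W + (N ∸ B j)) (j + m)
      row-chain e<M zero _ c = c
      row-chain {e} {m} e<M (suc j) {l} eq c =
        link (A (suc j)) (row<n fits e<M (s≤s (m∸n≤m N (B (suc j)))))
          (λ p<n l ag → no-smaller {j = j} e<M (spiral {j} eq i+B) p<n l (Agree-≤ (s≤s (B≤A j)) ag))
          (A>0 (suc j))
          (subst (λ y → Chain s n y (j + m)) (sym next-break) (row-chain e<M j (trans (+-suc j l) eq) c))
        where
        B≤N : B (suc j) ≤ N
        B≤N = subst (λ y → B (suc j) ≤ B y) (trans (+-comm l (suc j)) eq) (B-mono (suc j) l)
        i+B : N ∸ B (suc j) + B (suc j) ≡ N
        i+B = m∸n+n≡m B≤N
        next-break : e * W + (N ∸ B (suc j)) + A (suc j) ≡ e * W + (N ∸ B j)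
        next-break = trans (+-assoc (e * W) _ _) (cong (e * W +_) (+-cancelʳ-≡ (B j) _ _ (begin
          N ∸ B (suc j) + A (suc j) + B j   ≡⟨ +-assoc (N ∸ B (suc j)) (A (suc j)) (B j) ⟩
          N ∸ B (suc j) + B (suc j)         ≡⟨ i+B ⟩
          N                                 ≡⟨ m∸n+n≡m (≤-trans (<⇒≤ (B<B j)) B≤N) ⟨
          N ∸ B j + B j                     ∎)))
          where open ≡-Reasoning

    text-chain : ∀ r e → r + e ≡ M → Chain s n (e * W) (r * k)
    text-chain zero    e _  = end
    text-chain (suc r) e eq =
      subst (λ y → Chain s n y (suc r * k)) (trans (cong (e * W +_) (n∸n≡0 N)) (+-identityʳ (e * W)))
        (row-chain e<M k (+-identityʳ k) (skip next-row (text-chain r (suc e) (trans (+-suc r e) eq))))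
      where
      e<M : e < M
      e<M = subst (e <_) eq (s≤s (m≤n+m e r))
      next-row : e * W + N ≤ suc e * W
      next-row = ≤-trans (≤-reflexive (+-comm (e * W) N)) (+-monoˡ-≤ (e * W) (n≤1+n N))

    private
      q = B (suc k₀)
      p′ = pred x

      1+p′ : suc p′ ≡ x
      1+p′ = suc-pred x {{>-nonZero (A>0 k)}}

      -- This is Cassini's identity.
      x*x : x * x ≡ 1 + q * N
      x*x = proj₂ (convergents (suc k₀) {1} (+-comm (suc k₀) 1))

      -- The only obstacle is wraparound: `suc (o y′) = N` would give `o y = 0`, which is excluded
      -- for `0 < y < N`.
      o-suc : ∀ {y y′} u w → 0 < y → y < N → y * x + u * N ≡ suc (y′ * x) + w * N → o y ≡ suc (o y′)
      o-suc {y} {y′} u w 0<y y<N eq with c , qy ← quotient y′ with m≤n⇒m<n∨m≡n (o<N y′)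
      ... | inj₁ lt = residue-unique u (c + w) lt (trans eq (trans (cong (λ v → suc v + w * N) qy) (lemma (o y′) c w N)))
        where
        lemma : ∀ o c w N → suc (o + c * N) + w * N ≡ suc o + (c + w) * N
        lemma = solve-∀
      ... | inj₂ full = contradiction (residue-unique u (suc c + w) N>0 (begin
          y * x + u * N               ≡⟨ eq ⟩
          suc (y′ * x) + w * N        ≡⟨ cong (λ v → suc v + w * N) qy ⟩
          suc (o y′) + c * N + w * N  ≡⟨ cong (λ v → v + c * N + w * N) full ⟩
          N + c * N + w * N           ≡⟨ *-distribʳ-+ N (suc c) w ⟨
          (suc c + w) * N             ∎)) (≢-sym (<⇒≢ (o>0 y 0<y y<N)))
        where open ≡-Reasoning

      o-+x : ∀ i → i + x < N → o (i + x) ≡ suc (o i)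
      o-+x i lt = o-suc {i + x} {i} 0 q (<-≤-trans (A>0 k) (m≤n+m x i)) lt (begin
        (i + x) * x + 0       ≡⟨ +-identityʳ _ ⟩
        (i + x) * x           ≡⟨ *-distribʳ-+ x i x ⟩
        i * x + x * x         ≡⟨ cong (i * x +_) x*x ⟩
        i * x + (1 + q * N)   ≡⟨ +-suc (i * x) (q * N) ⟩
        suc (i * x) + q * N   ∎)
        where open ≡-Reasoning

      -- As `q + x = N`, going back by `q` amounts to going forward by `x` modulo `N`.
      o-∸q : ∀ j → 0 < j → q + j < N → o j ≡ suc (o (q + j))
      o-∸q j 0<j lt = o-suc {j} {q + j} x q 0<j (≤-<-trans (m≤n+m j q) lt) (begin
        j * x + x * N                    ≡⟨ cong (j * x +_) (trans (*-comm x N) (*-distribʳ-+ x x q)) ⟩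
        j * x + (x * x + q * x)          ≡⟨ cong (λ v → j * x + (v + q * x)) x*x ⟩
        j * x + (1 + q * N + q * x)      ≡⟨ lemma j q x N ⟩
        suc ((q + j) * x) + q * N        ∎)
        where
        open ≡-Reasoning
        lemma : ∀ j q x N → j * x + (1 + q * N + q * x) ≡ suc ((q + j) * x) + q * N
        lemma = solve-∀

      copy-left : ∀ {e} → suc e < M → Agree s (e * W + x) (suc e * W) q
      copy-left {e} e<M = agree λ i i<q →
        let i+x<N = subst (i + x <_) (+-comm q x) (+-monoˡ-< x i<q)
        in begin
          s (e * W + x + i)             ≡⟨ cong s (trans (+-assoc (e * W) x i) (cong (e * W +_) (+-comm x i))) ⟩
          s (e * W + (i + x))           ≡⟨ letter (<-trans ≤-refl e<M) i+x<N ⟩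
          suc (suc (e + o (i + x)))     ≡⟨ cong (λ v → suc (suc (e + v))) (o-+x i i+x<N) ⟩
          suc (suc (e + suc (o i)))     ≡⟨ cong (λ v → suc (suc v)) (+-suc e (o i)) ⟩
          suc (suc (suc e + o i))       ≡⟨ letter e<M (<-≤-trans i<q (m≤n+m q x)) ⟨
          s (suc e * W + i)             ∎
        where open ≡-Reasoning

      copy-right : ∀ {e} → suc e < M → Agree s (e * W + 1) (suc e * W + suc q) p′
      copy-right {e} e<M = agree λ i i<p′ →
        let j     = suc i
            q+j<N = subst (q + j <_) (+-comm q x) (+-monoʳ-< q (subst (suc i <_) 1+p′ (s≤s i<p′)))
        in begin
          s (e * W + 1 + i)                   ≡⟨ cong s (+-assoc (e * W) 1 i) ⟩
          s (e * W + j)                       ≡⟨ letter (<-trans ≤-refl e<M) (≤-<-trans (m≤n+m j q) q+j<N) ⟩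
          suc (suc (e + o j))                 ≡⟨ cong (λ v → suc (suc (e + v))) (o-∸q j (s≤s z≤n) q+j<N) ⟩
          suc (suc (e + suc (o (q + j))))     ≡⟨ cong (λ v → suc (suc v)) (+-suc e _) ⟩
          suc (suc (suc e + o (q + j)))       ≡⟨ letter e<M q+j<N ⟨
          s (suc e * W + (q + j))             ≡⟨ cong s (cong (suc e * W +_) (+-suc q i)) ⟩
          s (suc e * W + (suc q + i))         ≡⟨ cong s (+-assoc (suc e * W) (suc q) i) ⟨
          s (suc e * W + suc q + i)           ∎
        where open ≡-Reasoning

      literals : ∀ c {a m} → Cover s n (a + c) m → Cover s n a (c + m)
      literals zero    {a} {m} cov = subst (λ b → Cover s n b m) (+-identityʳ a) cov
      literals (suc c) {a} {m} cov = literal (literals c (subst (λ b → Cover s n b m) (+-suc a c) cov))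

      -- The 4 counts two blocks of the previous row, one letter and the separator. The single
      -- letter stands at position `q`, where `o q = N - 1`: it is the new maximum, while the
      -- previous minimum, at position 0, is left out of both blocks.
      row-cover : ∀ {e m} → suc e < M → Cover s n (suc (suc e) * W) m → Cover s n (suc e * W) (4 + m)
      row-cover {e} {m} e<M cov =
        copy q (subst (e * W + x <_) (+-comm (e * W) W) (+-monoʳ-< (e * W) x<W)) (<⇒≤ (row<n fits e<M q<W))
          (copy-left e<M)
          (literal (subst (λ b → Cover s n b (suc (suc m))) (+-suc (suc e * W) q)
            (copy p′ (+-mono-<-≤ (m<n+m (e * W) {W} (s≤s z≤n)) (s≤s z≤n))
              (subst (_≤ n) (sym to-end) (<⇒≤ (row<n fits e<M ≤-refl)))
              (copy-right e<M)
              (subst (λ b → Cover s n b (suc m)) (sym to-end)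
                (literal (subst (λ b → Cover s n b m) (trans (+-comm W (suc e * W)) (+-suc (suc e * W) N)) cov))))))
        where
        q<W : q < W
        q<W = s≤s (m≤n+m q x)
        x<W : x < W
        x<W = s≤s (m≤m+n x q)
        to-end : suc e * W + suc q + p′ ≡ suc e * W + N
        to-end = trans (+-assoc (suc e * W) (suc q) p′)
          (cong (suc e * W +_) (trans (+-comm (suc q) p′) (trans (+-suc p′ q) (cong (_+ q) 1+p′))))

      -- The padding repeats the last separator, so one self-overlapping copy from one position
      -- earlier suffices. Without padding, a literal past the end keeps the count uniform.
      padding-cover : 0 < M → Cover s n (M * W) 1
      padding-cover 0<M with m≤n⇒m<n∨m≡n fits
      ... | inj₂ eq = literal (done (subst (_≤ suc (M * W)) eq (n≤1+n (M * W))))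
      ... | inj₁ lt = copy (n ∸ M * W) (≤-reflexive 1+a) (≤-reflexive to-n)
                        (agree λ j j<n → trans (before-end j j<n) (sym (after-end j j<n))) (done (≤-reflexive (sym to-n)))
        where
        M′ = pred M
        1+M′ : suc M′ ≡ M
        1+M′ = suc-pred M {{>-nonZero 0<M}}
        a = M′ * W + N
        1+a : suc a ≡ M * W
        1+a = trans (sym (+-suc (M′ * W) N)) (trans (+-comm (M′ * W) W) (cong (_* W) 1+M′))
        to-n : M * W + (n ∸ M * W) ≡ n
        to-n = m+[n∸m]≡n fits
        after-end : ∀ j → j < n ∸ M * W → s (M * W + j) ≡ 1
        after-end j j<n = padding (m≤m+n (M * W) j) (subst (M * W + j <_) to-n (+-monoʳ-< (M * W) j<n))
        before-end : ∀ j → j < n ∸ M * W → s (a + j) ≡ 1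
        before-end zero    _   = trans (cong s (+-identityʳ a)) (separator (≤-reflexive 1+M′))
        before-end (suc j) j<n = trans (cong s (trans (+-suc a j) (cong (_+ j) 1+a)))
                                       (after-end j (<-trans ≤-refl j<n))

    text-cover : ∀ r e → r + suc e ≡ M → Cover s n (suc e * W) (r * 4 + 1)
    text-cover zero    e refl = padding-cover (s≤s z≤n)
    text-cover (suc r) e eq   =
      row-cover (subst (suc e <_) eq (s≤s (m≤n+m (suc e) r))) (text-cover r (suc e) (trans (+-suc r (suc e)) eq))

    module _ {lz plcp z v} (isLZ : IsLZ s n lz) (isPLCP : IsPLCP s n plcp)
             (lzRun : Run n lz 0 z) (lexRun : Run n (λ b → plcp b ⊔ 1) 0 v) where

      text-lex : M * k ≤ v
      text-lex = chain≤lex isPLCP (text-chain M 0 (+-identityʳ M)) lexRun z≤n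

      -- The first row is paid for with `W` literals, every later one with four phrases, and the
      -- padding with one.
      text-lz : 0 < M → z ≤ W + (pred M * 4 + 1)
      text-lz 0<M = lz-optimal isLZ
        (literals W (subst (λ b → Cover s n b (pred M * 4 + 1)) (+-identityʳ W)
          (text-cover (pred M) 0 (trans (+-comm (pred M) 1) (suc-pred M {{>-nonZero 0<M}})))))
        lzRun z≤n

-- The text as a string of prescribed length

code-tabulate : ∀ n (f : ℕ → ℕ) {i} → i < n → code (toList (tabulate {n = n} (f ∘ toℕ))) i ≡ suc (f i)
code-tabulate (suc n) f {zero}  _         = refl
code-tabulate (suc n) f {suc i} (s≤s i<n) = code-tabulate n (f ∘ suc) i<n

module _ (k₀ : ℕ) where
  open Rotation k₀
  open Text k₀

  textLetter : ℕ → ℕ → ℕ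
  textLetter M p with p / W <? M | p % W <? N
  ... | yes _ | yes _ = suc (p / W + o (p % W))
  ... | yes _ | no  _ = 0
  ... | no  _ | _     = 0

  private
    row-/ : ∀ e {i} → i < W → (e * W + i) / W ≡ e
    row-/ e {i} i<W = begin
      (e * W + i) / W      ≡⟨ cong (_/ W) (+-comm (e * W) i) ⟩
      (i + e * W) / W      ≡⟨ +-distrib-/-∣ʳ i (n∣m*n e) ⟩
      i / W + e * W / W    ≡⟨ cong₂ _+_ (m<n⇒m/n≡0 i<W) (m*n/n≡m e W) ⟩
      e                    ∎
      where open ≡-Reasoning

    row-% : ∀ e {i} → i < W → (e * W + i) % W ≡ i
    row-% e {i} i<W = trans (cong (_% W) (+-comm (e * W) i)) (trans ([m+kn]%n≡m%n i e W) (m<n⇒m%n≡m i<W))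

    p≡row : ∀ p → p ≡ p / W * W + p % W
    p≡row p = trans (m≡m%n+[m/n]*n p W) (+-comm (p % W) _)

  textLetter-inside : ∀ {M e i} → e < M → i < N → textLetter M (e * W + i) ≡ suc (e + o i)
  textLetter-inside {M} {e} {i} e<M i<N with (e * W + i) / W <? M | (e * W + i) % W <? N
  ... | yes _ | yes _ = cong₂ (λ a b → suc (a + o b)) (row-/ e (m≤n⇒m≤1+n i<N)) (row-% e (m≤n⇒m≤1+n i<N))
  ... | yes _ | no ≮N = contradiction (subst (_< N) (sym (row-% e (m≤n⇒m≤1+n i<N))) i<N) ≮N
  ... | no ≮M | _     = contradiction (subst (_< M) (sym (row-/ e (m≤n⇒m≤1+n i<N))) e<M) ≮M

  textLetter-separator : ∀ {M e} → textLetter M (e * W + N) ≡ 0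
  textLetter-separator {M} {e} with (e * W + N) / W <? M | (e * W + N) % W <? N
  ... | yes _ | yes <N = contradiction (subst (_< N) (row-% e ≤-refl) <N) (<-irrefl refl)
  ... | yes _ | no  _  = refl
  ... | no  _ | _      = refl

  textLetter-padding : ∀ {M p} → M * W ≤ p → textLetter M p ≡ 0
  textLetter-padding {M} {p} MW≤p with p / W <? M | p % W <? N
  ... | no  _  | _ = refl
  ... | yes _  | no  _ = refl
  ... | yes <M | yes _ = contradiction
    (subst (_≤ p / W) (m*n/n≡m M W) (/-monoˡ-≤ W MW≤p)) (<⇒≱ <M)

  textLetter-decode : ∀ {M p} → 0 < textLetter M p → ∃₂ λ e i → e < M × i < N × p ≡ e * W + i
  textLetter-decode {M} {p} pos with p / W <? M | p % W <? N
  ... | yes <M | yes <N = p / W , p % W , <M , <N , p≡row p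

  isText : ∀ {n M s} → M * W ≤ n → (∀ {i} → i < n → s i ≡ suc (textLetter M i)) → IsText s n M
  isText {n} {M} {s} fits s≡ = record
    { fits      = fits
    ; letter    = λ {e} e<M i<N → trans (s≡ (row<n fits e<M (m≤n⇒m≤1+n i<N))) (cong suc (textLetter-inside e<M i<N))
    ; separator = λ {e} e<M → trans (s≡ (row<n fits e<M ≤-refl)) (cong suc (textLetter-separator {M} {e}))
    ; padding   = λ MW≤p p<n → trans (s≡ p<n) (cong suc (textLetter-padding MW≤p))
    ; decode    = λ p<n 1<s → textLetter-decode (s≤s⁻¹ (subst (1 <_) (s≡ p<n) 1<s))
    }

  textString : ∀ n → ℕ → Vec ℕ n
  textString n M = tabulate (textLetter M ∘ toℕ)

  module _ {n M} (fits : M * W ≤ n) where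
    private
      S = toList (textString n M)
      module E = Encoding ℕ< (Embeds-id S)

      len : length S ≡ n
      len = length-toList (textString n M)

      text : IsText E.s (length S) M
      text = isText (subst (M * W ≤_) (sym len) fits) (λ {i} i< → trans
        (cong (λ l → code l i) (map-id S))
        (code-tabulate n (textLetter M) (subst (i <_) len i<)))

    textString-lex : M * k ≤ Parsing.v ℕ< (textString n M)
    textString-lex = text-lex text E.lzLength-isLZ E.maxSmallerLCP-isPLCP
      (lz-run ℕ< (Embeds-id S)) (lex-run ℕ< (Embeds-id S))

    textString-lz : 0 < M → Parsing.z ℕ< (textString n M) ≤ W + (pred M * 4 + 1)
    textString-lz = text-lz text E.lzLength-isLZ E.maxSmallerLCP-isPLCP
      (lz-run ℕ< (Embeds-id S)) (lex-run ℕ< (Embeds-id S))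

-- Constants and the asymptotic bounds

v≤log*z : ∀ {n} (S : Vec ℕ n) → Parsing.v ℕ< S ≤ suc ⌊log₂ n ⌋ * (suc (Parsing.z ℕ< S) * 5)
v≤log*z S = subst (λ n → Parsing.v ℕ< S ≤ suc ⌊log₂ n ⌋ * (suc (Parsing.z ℕ< S) * 5)) (length-toList S)
  (UpperBound.lex≤lz*log E.isCode E.lzLength-isLZ E.maxSmallerLCP-isPLCP
    (lz-run ℕ< (Embeds-id (toList S))) (lex-run ℕ< (Embeds-id (toList S))))
  where module E = Encoding ℕ< (Embeds-id (toList S))

A≤4^ : ∀ l → A l ≤ 4 ^ l
2*B≤4^ : ∀ l → 2 * B l ≤ 4 ^ l

A≤4^ zero    = ≤-refl
A≤4^ (suc l) = ≤-trans (+-mono-≤ (A≤4^ l) (≤-trans (m≤n*m (B l) 2) (2*B≤4^ l))) (+-monoʳ-≤ (4 ^ l) (m≤m+n (4 ^ l) _))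

2*B≤4^ zero    = z≤n
2*B≤4^ (suc l) = begin
  2 * (A l + B l + B l)                ≡⟨ lemma (A l) (B l) ⟩
  2 * A l + (2 * B l + 2 * B l)        ≤⟨ +-mono-≤ (*-monoʳ-≤ 2 (A≤4^ l)) (+-mono-≤ (2*B≤4^ l) (2*B≤4^ l)) ⟩
  2 * 4 ^ l + (4 ^ l + 4 ^ l)          ≡⟨ lemma′ (4 ^ l) ⟩
  4 * 4 ^ l                            ∎
  where
  open ≤-Reasoning
  lemma : ∀ a b → 2 * (a + b + b) ≡ 2 * a + (2 * b + 2 * b)
  lemma = solve-∀
  lemma′ : ∀ a → 2 * a + (a + a) ≡ 4 * a
  lemma′ = solve-∀

2^log≤2* : ∀ n → 0 < n → 2 ^ ⌊log₂ n ⌋ ≤ 2 * n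
2^log≤2* n 0<n with σ , lo , hi ← scale n 0<n = ≤-trans
  (^-monoʳ-≤ 2 (subst (⌊log₂ n ⌋ ≤_) (⌊log₂[2^n]⌋≡n (suc σ)) (⌊log₂⌋-mono-≤ (<⇒≤ hi))))
  (*-monoʳ-≤ 2 lo)

-- With `k` a quarter of `L`, `N * W` is at most `n`, so at least `N` rows fit and they absorb the
-- cost of the first one: the LZ count is at most `5 * M`. Together with `L ≤ 8 * k` this gives 40.
-- The threshold 256 is `2 ^ 8`, which makes `L / 4` at least 2, the least `k` allowed.
manyPhrases : ∀ n → 256 ≤ n →
              Σ[ S ∈ Vec ℕ n ] ⌊log₂ n ⌋ * Parsing.z ℕ< S ≤ 40 * Parsing.v ℕ< S
manyPhrases n 256≤n = textString k₀ n M , bound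
  where
  L = ⌊log₂ n ⌋
  8≤L : 8 ≤ L
  8≤L = subst (_≤ L) (⌊log₂[2^n]⌋≡n 8) (⌊log₂⌋-mono-≤ 256≤n)
  2≤L/4 : 2 ≤ L / 4
  2≤L/4 = /-monoˡ-≤ 4 8≤L
  k₀ = L / 4 ∸ 2
  open Rotation k₀
  open Text k₀
  k≡ : k ≡ L / 4
  k≡ = m+[n∸m]≡n 2≤L/4
  M = n / W
  MW≤n : M * W ≤ n
  MW≤n = m/n*n≤m n W
  1≤n : 1 ≤ n
  1≤n = ≤-trans (s≤s z≤n) 256≤n
  W≤4^k : W ≤ 4 ^ k
  W≤4^k = ≤-trans (≤-trans (+-monoˡ-≤ N N>0) (≤-reflexive (cong (N +_) (sym (+-identityʳ N))))) (2*B≤4^ k)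
  NW≤n : N * W ≤ n
  NW≤n = *-cancelˡ-≤ 2 (begin
    2 * (N * W)          ≡⟨ *-assoc 2 N W ⟨
    2 * N * W            ≤⟨ *-mono-≤ (2*B≤4^ k) W≤4^k ⟩
    4 ^ k * 4 ^ k        ≡⟨ cong₂ _*_ (^-*-assoc 2 2 k) (^-*-assoc 2 2 k) ⟩
    2 ^ (2 * k) * 2 ^ (2 * k) ≡⟨ ^-distribˡ-+-* 2 (2 * k) (2 * k) ⟨
    2 ^ (2 * k + 2 * k)  ≡⟨ cong (2 ^_) (lemma k) ⟩
    2 ^ (k * 4)          ≤⟨ ^-monoʳ-≤ 2 (subst (λ y → y * 4 ≤ L) (sym k≡) (m/n*n≤m L 4)) ⟩
    2 ^ L                ≤⟨ 2^log≤2* n 1≤n ⟩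
    2 * n                ∎)
    where
    open ≤-Reasoning
    lemma : ∀ k → 2 * k + 2 * k ≡ k * 4
    lemma = solve-∀
  N≤M : N ≤ M
  N≤M = subst (_≤ M) (m*n/n≡m N W) (/-monoˡ-≤ W NW≤n)
  0<M : 0 < M
  0<M = ≤-trans N>0 N≤M
  z≤5M : Parsing.z ℕ< (textString k₀ n M) ≤ 5 * M
  z≤5M = ≤-trans (textString-lz k₀ MW≤n 0<M) (begin
    W + (pred M * 4 + 1)                     ≤⟨ +-monoˡ-≤ (pred M * 4 + 1) (s≤s N≤M) ⟩
    suc M + (pred M * 4 + 1)                 ≤⟨ +-monoˡ-≤ (pred M * 4 + 1) (s≤s (≤-reflexive (sym 1+M′))) ⟩
    2 + pred M + (pred M * 4 + 1)            ≤⟨ m≤n+m _ 2 ⟩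
    2 + (2 + pred M + (pred M * 4 + 1))      ≡⟨ lemma (pred M) ⟩
    5 * suc (pred M)                         ≡⟨ cong (5 *_) 1+M′ ⟩
    5 * M                                    ∎)
    where
    open ≤-Reasoning
    1+M′ : suc (pred M) ≡ M
    1+M′ = suc-pred M {{>-nonZero 0<M}}
    lemma : ∀ m → 2 + (2 + m + (m * 4 + 1)) ≡ 5 * suc m
    lemma = solve-∀
  L≤8k : L ≤ 8 * k
  L≤8k = begin
    L                     ≡⟨ m≡m%n+[m/n]*n L 4 ⟩
    L % 4 + L / 4 * 4     ≡⟨ cong (λ y → L % 4 + y * 4) k≡ ⟨
    L % 4 + k * 4         ≤⟨ +-monoˡ-≤ (k * 4) (≤-trans (<⇒≤ (m%n<n L 4)) (m≤n*m 4 k)) ⟩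
    k * 4 + k * 4         ≡⟨ lemma k ⟩
    8 * k                 ∎
    where
    open ≤-Reasoning
    lemma : ∀ k → k * 4 + k * 4 ≡ 8 * k
    lemma = solve-∀
  bound : L * Parsing.z ℕ< (textString k₀ n M) ≤ 40 * Parsing.v ℕ< (textString k₀ n M)
  bound = begin
    L * Parsing.z ℕ< (textString k₀ n M)   ≤⟨ *-mono-≤ L≤8k z≤5M ⟩
    8 * k * (5 * M)                        ≡⟨ lemma k M ⟩
    40 * (M * k)                           ≤⟨ *-monoʳ-≤ 40 (textString-lex k₀ MW≤n) ⟩
    40 * Parsing.v ℕ< (textString k₀ n M)  ∎
    where
    open ≤-Reasoning
    lemma : ∀ k M → 8 * k * (5 * M) ≡ 40 * (M * k)
    lemma = solve-∀

fraction≤ : ∀ a b c d e f .{{_ : NonZero b}} .{{_ : NonZero d}} .{{_ : NonZero f}} →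
            a * c * f ≤ e * (b * d) → (ℤ.+ a ℚ./ b) ℚ.* (ℤ.+ c ℚ./ d) ℚ.≤ (ℤ.+ e ℚ./ f)
fraction≤ a (suc b) c (suc d) e (suc f) h = ℚ.toℚᵘ-cancel-≤
  (ℚᵘ.≤-respʳ-≃ (ℚᵘ.≃-sym (ℚ.toℚᵘ-fromℚᵘ (mkℚᵘ (ℤ.+ e) f)))
    (ℚᵘ.≤-respˡ-≃ (ℚᵘ.≃-sym (ℚᵘ.≃-trans (ℚ.toℚᵘ-homo-* (ℤ.+ a ℚ./ suc b) (ℤ.+ c ℚ./ suc d))
        (ℚᵘ.*-cong (ℚ.toℚᵘ-fromℚᵘ (mkℚᵘ (ℤ.+ a) b)) (ℚ.toℚᵘ-fromℚᵘ (mkℚᵘ (ℤ.+ c) d)))))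
      (*≤* (subst₂ ℤ._≤_ (trans (ℤ.pos-* (a * c) (suc f)) (cong (ℤ._* ℤ.+ suc f) (ℤ.pos-* a c)))
                         (ℤ.pos-* e (suc b * suc d)) (ℤ.+≤+ h)))))

≤fraction : ∀ a b c d e f .{{_ : NonZero b}} .{{_ : NonZero d}} .{{_ : NonZero f}} →
            e * (b * d) ≤ a * c * f → (ℤ.+ e ℚ./ f) ℚ.≤ (ℤ.+ a ℚ./ b) ℚ.* (ℤ.+ c ℚ./ d)
≤fraction a (suc b) c (suc d) e (suc f) h = ℚ.toℚᵘ-cancel-≤
  (ℚᵘ.≤-respˡ-≃ (ℚᵘ.≃-sym (ℚ.toℚᵘ-fromℚᵘ (mkℚᵘ (ℤ.+ e) f)))
    (ℚᵘ.≤-respʳ-≃ (ℚᵘ.≃-sym (ℚᵘ.≃-trans (ℚ.toℚᵘ-homo-* (ℤ.+ a ℚ./ suc b) (ℤ.+ c ℚ./ suc d))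
        (ℚᵘ.*-cong (ℚ.toℚᵘ-fromℚᵘ (mkℚᵘ (ℤ.+ a) b)) (ℚ.toℚᵘ-fromℚᵘ (mkℚᵘ (ℤ.+ c) d)))))
      (*≤* (subst₂ ℤ._≤_ (ℤ.pos-* e (suc b * suc d))
                         (trans (ℤ.pos-* (a * c) (suc f)) (cong (ℤ._* ℤ.+ suc f) (ℤ.pos-* a c))) (ℤ.+≤+ h)))))

v/z-lower : ∀ {n} .{{_ : NonZero n}} (S : Vec ℕ n) → ⌊log₂ n ⌋ * Parsing.z ℕ< S ≤ 40 * Parsing.v ℕ< S →
            (ℤ.+ 1 ℚ./ 40) ℚ.* log n ℚ.≤ v/z ℕ< S
v/z-lower {n} S h = fraction≤ 1 40 ⌊log₂ n ⌋ 1 (Parsing.v ℕ< S) (Parsing.z ℕ< S) {{_}} {{_}} {{Parsing.z-nonZero ℕ< S}}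
  (subst₂ _≤_ (cong (_* Parsing.z ℕ< S) (sym (*-identityˡ ⌊log₂ n ⌋))) (*-comm 40 (Parsing.v ℕ< S)) h)

v/z-upper : ∀ {n} .{{_ : NonZero n}} (S : Vec ℕ n) → 2 ≤ n → v/z ℕ< S ℚ.≤ (ℤ.+ 20 ℚ./ 1) ℚ.* log n
v/z-upper {n} S 2≤n = ≤fraction 20 1 L 1 v z {{_}} {{_}} {{Parsing.z-nonZero ℕ< S}} (begin
  v * 1                    ≡⟨ *-identityʳ v ⟩
  v                        ≤⟨ v≤log*z S ⟩
  -- 20 is 2 · 2 · 5: as `L` and `z` are at least 1, each of the two successors at most doubles its
  -- argument.
  suc L * (suc z * 5)      ≤⟨ *-mono-≤ (+-monoˡ-≤ L 1≤L)
                                (*-monoˡ-≤ 5 (+-monoˡ-≤ z (>-nonZero⁻¹ z {{Parsing.z-nonZero ℕ< S}}))) ⟩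
  (L + L) * ((z + z) * 5)  ≡⟨ lemma L z ⟩
  20 * L * z               ∎)
  where
  open ≤-Reasoning
  L = ⌊log₂ n ⌋
  v = Parsing.v ℕ< S
  z = Parsing.z ℕ< S
  1≤L : 1 ≤ L
  1≤L = subst (_≤ L) (⌊log₂[2^n]⌋≡n 1) (⌊log₂⌋-mono-≤ 2≤n)
  lemma : ∀ L z → (L + L) * ((z + z) * 5) ≡ 20 * L * z
  lemma = solve-∀

Ratio-lower : ∀ n → 256 ≤ n → (ℤ.+ 1 ℚ./ 40) ℚ.* log n ℚ.≤ Ratio n
Ratio-lower n@(suc _) 256≤n = ℚ.≤-trans (v/z-lower S (proj₂ (manyPhrases n 256≤n))) (proj₂ (Ratio-isMax n) ℕ< S)
  where
  S : Vec ℕ n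
  S = proj₁ (manyPhrases n 256≤n)

Ratio-upper : ∀ n → 256 ≤ n → Ratio n ℚ.≤ (ℤ.+ 20 ℚ./ 1) ℚ.* log n
Ratio-upper n@(suc _) 256≤n = v/z-upper (bestString n) (≤-trans (s≤s (s≤s z≤n)) 256≤n)

corollary21 : Σ[ Ratio ∈ (ℕ → ℚ) ] (∀ (n : ℕ) .{{_ : NonZero n}} → IsMaxRatio n (Ratio n)) × Ratio ∈Θ log
corollary21 = Ratio , (λ n → Ratio-isMax n) , (ℤ.+ 1 ℚ./ 40) , (ℤ.+ 20 ℚ./ 1) ,
  ℚ.positive⁻¹ (ℤ.+ 1 ℚ./ 40) , ℚ.positive⁻¹ (ℤ.+ 20 ℚ./ 1) , 256 ,
  λ n n≥256 → Ratio-lower n n≥256 , Ratio-upper n n≥256
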